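{- The map $\rho=(\rho_N,\rho_Q)$ is a bijection \[\rho:\mathcal M(L,n)\to\bigcup_{\mu}\mathrm{MLQ}_0(\mu,n)\times\mathrm{SSYT}(\mu',L),\] and it satisfies $x^B=x^{\rho_N(B)}$ for every $B\in\mathcal M(L,n)$.
   Context: $\mathcal M(L,n)$: tuples $B=(B_1,\dots,B_L)$ of subsets of $[n]$, drawn with rows $1..L$ bottom to top and columns $1..n$ left to right, a ball at $(r,j)$ iff $j\in B_r$; spectral weight $x^B=\prod_r\prod_{b\in B_r}x_b$. $\mathrm{cw}(B)$ records row numbers of balls scanning columns left to right, each column top to bottom. For $i\ge1$, $\mathrm{Par}_i(w)$ writes "(" for each $i+1$ and ")" for each $i$ of $w$ read left to right, matching iteratively when "(" is immediately followed by ")" or separated only by matched parentheses; a ball of row $i+1$ is unmatched above if its letter is unmatched in $\mathrm{Par}_i(\mathrm{cw}(B))$. $e_i^\star$ moves every ball of row $i+1$ unmatched above to row $i$ (same column). Operators compose right to left, $e^\star_{[a,b]}=e^\star_a\cdots e^\star_b$. $\rho_N(B)=e^\star_{[1,L-1]}\cdots e^\star_{[1,1]}(B)$. For $0\le k\le L$ let $c^{(k)}_r$ be the number of balls in row $r$ of $e^\star_{[1,k-1]}\cdots e^\star_{[1,1]}(B)$ if $r\le k$ ($=B$ for $k=1$) and $0$ if $r>k$; $\rho_Q(B)$ is the French-notation filling whose row $r$ (from the bottom) has $c^{(k)}_r-c^{(k-1)}_r$ entries equal to $k$, $k=1..L$, in increasing order. A multiline queue of shape $\mu$ on $n$ columns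 is a tuple of subsets of $[n]$ with $\mu'_r$ elements in row $r$; elements of $\mathcal M(L,n)$ with weakly decreasing row sizes are regarded as such (trailing empty rows ignored). Ferrari–Martin labelling: for $r$ from the top row down to $2$, unlabelled balls of row $r$ get label $r$; balls of row $r$, by decreasing label and left to right among ties, are each paired with the first not yet labelled ball of row $r-1$ weakly to the right, cyclically (column $n$ to column $1$), which gets the same label; a pairing wraps if it passes from column $n$ to column $1$. $\mathrm{maj}=\sum(\ell-r+1)$ over wrapping pairings ($\ell$ label, $r$ starting row). $\mathrm{MLQ}_0(\mu,n)$: multiline queues of shape $\mu$ on $n$ columns with $\mathrm{maj}=0$. $\mathrm{SSYT}(\nu,L)$: semistandard tableaux of shape $\nu$ (French notation: rows weakly increasing, columns strictly increasing upward) with entries at most $L$. The union is over partitions $\mu$. -}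

module Defs where

open import Level using (Level)
open import Data.Bool using (Bool; true; false; if_then_else_; _∧_)
open import Data.Nat using (ℕ; zero; suc; _+_; _∸_; _≤_; _<_; _≥_; _≡ᵇ_; _≤ᵇ_; _⊔_)
open import Data.Fin using (Fin; toℕ)
open import Data.Fin.Subset using (Subset; ∣_∣; _∪_; _∩_; ∁; ⁅_⁆)
import Data.Fin.Subset as Sub
open import Data.List using (List; []; _∷_; _++_; map; concatMap; reverse; length; allFin; downFrom; upTo; replicate; filter; foldr; zip; null)
open import Data.List.Relation.Unary.All using (All)
open import Data.List.Relation.Unary.Linked using (Linked)
open import Data.Vec using (Vec; lookup; tabulate; toList)
open import Data.Maybe using (Maybe; just; nothing)
open import Data.Product using (_×_; _,_; Σ; proj₁; proj₂)
open import Relation.Binary.PropositionalEquality using (_≡_)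
open import Algebra.Bundles using (CommutativeMonoid)

-- Ball systems  M(L,n).  Row r (1-based, bottom = 1) is  lookup B (r-1).

BallSystem : ℕ → ℕ → Set
BallSystem L n = Vec (Subset n) L

members : ∀ {n} → Subset n → List (Fin n)
members {n} R = go (allFin n)
  where
  go : List (Fin n) → List (Fin n)
  go [] = []
  go (j ∷ js) = if lookup R j then j ∷ go js else go js

weight : ∀ {c ℓ} (M : CommutativeMonoid c ℓ) {L n : ℕ} →
         (Fin n → CommutativeMonoid.Carrier M) → BallSystem L n → CommutativeMonoid.Carrier M
weight M x B = foldr (λ R acc → rowW R ∙ acc) ε (toList B)
  where
  open CommutativeMonoid M
  rowW = λ R → foldr (λ j acc → x j ∙ acc) ε (members R)

-- column word: columns left to right, each column top to bottom;
-- each letter is (row number (1-based) , column)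
cw : ∀ {L n} → BallSystem L n → List (ℕ × Fin n)
cw {L} {n} B =
  concatMap (λ j → concatMap (λ r → if lookup (lookup B r) j then (suc (toℕ r) , j) ∷ [] else [])
                             (reverse (allFin L)))
            (allFin n)

-- Par_i: letters i+1 are "(" and letters i are ")"; the matching is computed
-- with the usual stack: the result is the list of columns of the letters
-- i+1 (balls of row i+1) that are unmatched.
unmatchedAbove : ∀ {n} → ℕ → List (ℕ × Fin n) → List (Fin n)
unmatchedAbove {n} i w = go w []
  where
  pop : List (Fin n) → List (Fin n)
  pop [] = []
  pop (_ ∷ s) = s
  go : List (ℕ × Fin n) → List (Fin n) → List (Fin n)
  go [] st = st
  go ((r , j) ∷ w') st =
    if r ≡ᵇ suc i then go w' (j ∷ st)
    else if r ≡ᵇ i then go w' (pop st)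
    else go w' st

toSubset : ∀ {n} → List (Fin n) → Subset n
toSubset = foldr (λ j S → ⁅ j ⁆ ∪ S) Sub.⊥

-- e_i^⋆ : moves every ball of row i+1 unmatched above to row i (same column).
-- (identity for i = 0, which is never used)
e⋆ : ∀ {L n} → ℕ → BallSystem L n → BallSystem L n
e⋆ zero B = B
e⋆ {L} {n} (suc i') B = tabulate newRow
  where
  i = suc i'
  U = toSubset (unmatchedAbove i (cw B))
  newRow : Fin L → Subset n
  newRow r = if toℕ r ≡ᵇ i then lookup B r ∩ ∁ U            -- row i+1
             else if suc (toℕ r) ≡ᵇ i then lookup B r ∪ U    -- row i
             else lookup B r

e⋆[1,_] : ∀ {L n} → ℕ → BallSystem L n → BallSystem L n
e⋆[1, zero ] B = B
e⋆[1, suc k ] B = e⋆[1, k ] (e⋆ (suc k) B)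

pre : ∀ {L n} → ℕ → BallSystem L n → BallSystem L n
pre zero B = B
pre (suc m) B = e⋆[1, suc m ] (pre m B)

ρN : ∀ {L n} → BallSystem L n → BallSystem L n
ρN {L} B = pre (L ∸ 1) B

stripTop : ∀ {A : Set} → (A → Bool) → List A → List A
stripTop isEmpty = foldr (λ R acc → if null acc ∧ isEmpty R then [] else R ∷ acc) []

ρN-MLQ : ∀ {L n} → BallSystem L n → List (Subset n)
ρN-MLQ B = stripTop (λ R → ∣ R ∣ ≡ᵇ 0) (toList (ρN B))

nth : List ℕ → ℕ → ℕ
nth [] _ = 0
nth (a ∷ as) zero = a
nth (a ∷ as) (suc k) = nth as k

-- c^{(k)}_r  (k, r 1-based;  r ≥ 1)
cnt : ∀ {L n} → BallSystem L n → ℕ → ℕ → ℕ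
cnt B zero r = 0
cnt B (suc k) r = if r ≤ᵇ suc k then nth (map ∣_∣ (toList (pre k B))) (r ∸ 1) else 0

-- Tableaux in French notation: list of rows from the bottom
Tableau : Set
Tableau = List (List ℕ)

ρQ : ∀ {L n} → BallSystem L n → Tableau
ρQ {L} B = stripTop null (map row (map suc (upTo L)))
  where
  row : ℕ → List ℕ
  row r = concatMap (λ k → replicate (cnt B k r ∸ cnt B (k ∸ 1) r) k) (map suc (upTo L))

ρ : ∀ {L n} → BallSystem L n → List (Subset n) × Tableau
ρ B = ρN-MLQ B , ρQ B

IsPartition : List ℕ → Set
IsPartition μ = Linked _≥_ μ × All (λ a → 1 ≤ a) μ

conj : List ℕ → List ℕ
conj μ = map (λ r → length (filter (λ a → r Data.Nat.≤? a) μ)) (map suc (upTo (foldr _⊔_ 0 μ)))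

-- Ferrari–Martin labelling and maj of a multiline queue
-- (list of rows, bottom row first; columns 0-based; labels / rows 1-based)

cols : ∀ {n} → Subset n → List ℕ
cols R = map toℕ (members R)

-- first available column weakly to the right of j, cyclically; the Bool says
-- whether the pairing wraps around (column n → column 1)
choose : ℕ → List ℕ → Maybe (ℕ × Bool)
choose j avail with filter (λ c → j Data.Nat.≤? c) avail
... | c ∷ _ = just (c , false)
... | [] with avail
...   | c ∷ _ = just (c , true)
...   | [] = nothing

removeCol : ℕ → List ℕ → List ℕ
removeCol c [] = []
removeCol c (d ∷ ds) = if c ≡ᵇ d then ds else d ∷ removeCol c ds

-- pair the (ordered) balls of row r with the available balls below;
-- returns the labelled balls of row r-1 and the maj contribution
pairAll : ℕ → List (ℕ × ℕ) → List ℕ → List (ℕ × ℕ) × ℕ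
pairAll r [] avail = [] , 0
pairAll r ((j , ℓ) ∷ rest) avail with choose j avail
... | nothing = pairAll r rest avail
... | just (c , wrap) with pairAll r rest (removeCol c avail)
...   | ps , mj = (c , ℓ) ∷ ps , ((if wrap then ℓ + 1 ∸ r else 0) + mj)

labelOf : ℕ → List (ℕ × ℕ) → ℕ → ℕ
labelOf c [] dflt = dflt
labelOf c ((d , ℓ) ∷ ps) dflt = if c ≡ᵇ d then ℓ else labelOf c ps dflt

-- balls of row r ordered by decreasing label, left to right among ties
-- (labels are at most m, the number of rows)
orderBalls : ℕ → List (ℕ × ℕ) → List (ℕ × ℕ)
orderBalls m lab = concatMap (λ ℓ → filter (λ p → proj₂ p Data.Nat.≟ ℓ) lab) (downFrom (suc m))

-- r: current row; lab: labelled balls of row r (column order); remaining rows r-1, r-2, … downward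
fmGo : ∀ {n} → ℕ → ℕ → List (ℕ × ℕ) → List (Subset n) → ℕ
fmGo m r lab [] = 0
fmGo m r lab (R' ∷ rest) with pairAll r (orderBalls m lab) (cols R')
... | paired , mj = mj + fmGo m (r ∸ 1) (map (λ c → c , labelOf c paired (r ∸ 1)) (cols R')) rest

maj : ∀ {n} → List (Subset n) → ℕ
maj {n} M with reverse M
... | [] = 0
... | R ∷ rest = fmGo (length M) (length M) (map (λ c → c , length M) (cols R)) rest

IsMLQ₀ : (μ : List ℕ) (n : ℕ) → List (Subset n) → Set
IsMLQ₀ μ n M = map ∣_∣ M ≡ conj μ × maj M ≡ 0

StrictlyBelow : List ℕ → List ℕ → Set
StrictlyBelow R R' = All (λ p → proj₁ p < proj₂ p) (zip R R')

IsSSYT : (ν : List ℕ) (L : ℕ) → Tableau → Set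
IsSSYT ν L T = map length T ≡ ν
             × All (Linked _≤_) T
             × All (All (λ a → 1 ≤ a × a ≤ L)) T
             × Linked StrictlyBelow T

InTarget : (L n : ℕ) → List (Subset n) × Tableau → Set
InTarget L n (M , T) = Σ (List ℕ) λ μ → IsPartition μ × IsMLQ₀ μ n M × IsSSYT (conj μ) L T

{-# OPTIONS --safe #-}
module Submission where

-- Write r(p) for the number of balls of a row r in columns ≥ p.  The operator moves
-- u(p) = max_{q≥p} (y(q) − x(q))⁺ balls from the upper row y to the lower row x, so
-- e⋆[1, k ] adds row k+1 to a system in which every row is dominated, suffix by suffix, by the
-- row below it; the maxima give that this property persists and that old and new rows interlace,
-- which is semistandardness of ρQ.  A single operator is inverted by raising the rightmost u
-- unmatched balls, and interlacing of sizes is exactly what makes the reverse process legal.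
-- Finally, the Ferrari–Martin pairings never wrap precisely when each row is dominated by the next.

open import Defs
open import Data.Nat
open import Data.Nat.Properties
open import Data.Bool using (Bool; true; false; if_then_else_; T)
open import Data.Fin using (Fin; toℕ; zero; suc; fromℕ<)
open import Data.Fin.Properties using (toℕ-fromℕ<)
open import Data.Fin.Subset using (Subset; ∣_∣; _∪_; _∩_; ∁; ⁅_⁆)
import Data.Fin.Subset as Sub
open import Data.Fin.Subset.Properties using (∪-identityʳ; ∣⊥∣≡0)
open import Data.Vec using (Vec; []; _∷_; lookup; toList; fromList)
import Data.Vec as Vec
open import Data.Vec.Properties using (tabulate∘lookup; length-toList; cast-is-id; toList-injective; toList∘fromList)
open import Data.Maybe using (Maybe; just; nothing)
open import Data.List using (List; []; _∷_; _++_; _∷ʳ_; _ʳ++_; map; concatMap; filter; foldl; foldr; length; null;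
  take; drop; reverse; replicate; tabulate; allFin; applyUpTo; upTo; downFrom)
open import Data.List.Properties
open import Data.List.Relation.Unary.All using (All; []; _∷_)
import Data.List.Relation.Unary.All as All
import Data.List.Relation.Unary.All.Properties as All
open import Data.List.Relation.Unary.AllPairs using (AllPairs; []; _∷_)
import Data.List.Relation.Unary.AllPairs.Properties as AllPairs
open import Data.List.Relation.Unary.Linked using (Linked; []; [-]; _∷_)
import Data.List.Relation.Unary.Linked as Linked
import Data.List.Relation.Unary.Linked.Properties as Linked
open import Data.Product using (_×_; _,_; ∃; proj₁; proj₂)
open import Data.Sum using (inj₁; inj₂)
open import Data.Empty using (⊥-elim)
open import Function using (_∘_; id; flip)
open import Relation.Nullary using (yes; no)
open import Relation.Nullary.Decidable using (dec-true; dec-false)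
open import Relation.Binary.Definitions using (tri<; tri≈; tri>)
open import Relation.Binary.PropositionalEquality hiding (setoid; isEquivalence)
open import Algebra.Bundles using (CommutativeMonoid)
import Algebra.Properties.CommutativeSemigroup as CommutativeSemigroupProperties
import Relation.Binary.Reasoning.Setoid as SetoidReasoning

-- Domination of rows and one application of e⋆

-- After a drop, a fallen ball and an unmatched ball that was in the lower row all along look alike;
-- only their total is visible, as the difference of the two new row sizes. Taken in every suffix,
-- this difference still locates the fallen balls once their number is known. That number is what
-- the tableau keeps, since it records all row sizes after each round. The delicate object in both
-- directions is a row in the middle of a round, which first gains balls from above and then loses
-- balls downwards. Forwards, it must still dominate its old self after the loss. Backwards, the
-- interlacing inequalities have separate uses: a new row being no larger than the old row below it
-- keeps the number of lifted balls within the visible total, and an old row being no larger than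
-- the new row at its own height keeps the lifted rows dominated.

infix 4 _≼_

-- The tail of a vector holds the columns further right. One inequality is stored per suffix, so
-- that a recursion over columns has the bound for each suffix at hand.
data _≼_ : ∀ {n} → Subset n → Subset n → Set where
  []  : [] ≼ []
  _∷_ : ∀ {n a b} {p q : Subset n} → ∣ a ∷ p ∣ ≤ ∣ b ∷ q ∣ → p ≼ q → (a ∷ p) ≼ (b ∷ q)

≼-size : ∀ {n} {p q : Subset n} → p ≼ q → ∣ p ∣ ≤ ∣ q ∣
≼-size []        = z≤n
≼-size (p≤q ∷ _) = p≤q

≼-trans : ∀ {n} {p q r : Subset n} → p ≼ q → q ≼ r → p ≼ r
≼-trans []      []      = []
≼-trans (x ∷ p) (y ∷ q) = ≤-trans x y ∷ ≼-trans p q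

-- Row x below row y becomes x′ below y′: u balls fall and s balls of x stay unmatched.  The head of a
-- vector is the leftmost column, so a ball can only be matched in its own column or in the tail.
data Drop : ∀ {n} (x y x′ y′ : Subset n) (s u : ℕ) → Set where
  done    : Drop [] [] [] [] 0 0
  neither : ∀ {n s u} {x y x′ y′ : Subset n} → Drop x y x′ y′ s u →
            Drop (false ∷ x) (false ∷ y) (false ∷ x′) (false ∷ y′) s u
  both    : ∀ {n s u} {x y x′ y′ : Subset n} → Drop x y x′ y′ s u →
            Drop (true ∷ x) (true ∷ y) (true ∷ x′) (true ∷ y′) s u
  close   : ∀ {n s u} {x y x′ y′ : Subset n} → Drop x y x′ y′ s u →
            Drop (true ∷ x) (false ∷ y) (true ∷ x′) (false ∷ y′) (suc s) u
  match   : ∀ {n s u} {x y x′ y′ : Subset n} → Drop x y x′ y′ (suc s) u →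
            Drop (false ∷ x) (true ∷ y) (false ∷ x′) (true ∷ y′) s u
  fall    : ∀ {n u} {x y x′ y′ : Subset n} → Drop x y x′ y′ 0 u →
            Drop (false ∷ x) (true ∷ y) (true ∷ x′) (false ∷ y′) 0 (suc u)

lower-size : ∀ {n s u} {x y x′ y′ : Subset n} → Drop x y x′ y′ s u → ∣ x′ ∣ ≡ u + ∣ x ∣
lower-size done                = refl
lower-size (neither d)         = lower-size d
lower-size {u = u} (both d)    = trans (cong suc (lower-size d)) (sym (+-suc u _))
lower-size {u = u} (close d)   = trans (cong suc (lower-size d)) (sym (+-suc u _))
lower-size (match d)           = lower-size d
lower-size (fall d)            = cong suc (lower-size d)

upper-size : ∀ {n s u} {x y x′ y′ : Subset n} → Drop x y x′ y′ s u → ∣ y ∣ ≡ u + ∣ y′ ∣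
upper-size done                = refl
upper-size (neither d)         = upper-size d
upper-size {u = u} (both d)    = trans (cong suc (upper-size d)) (sym (+-suc u _))
upper-size (close d)           = upper-size d
upper-size {u = u} (match d)   = trans (cong suc (upper-size d)) (sym (+-suc u _))
upper-size (fall d)            = cong suc (upper-size d)

-- The surviving upper balls are exactly the matched ones, each with its own partner in `x`; the
-- other `s` balls of `x` are unmatched.
slack-size : ∀ {n s u} {x y x′ y′ : Subset n} → Drop x y x′ y′ s u → ∣ x ∣ ≡ s + ∣ y′ ∣
slack-size done              = refl
slack-size (neither d)       = slack-size d
slack-size {s = s} (both d)  = trans (cong suc (slack-size d)) (sym (+-suc s _))
slack-size (close d)         = cong suc (slack-size d)
slack-size {s = s} (match d) = trans (slack-size d) (sym (+-suc s _))
slack-size (fall d)          = slack-size d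

-- The sum `u + s` can thus be read from the result alone, which is the key to undoing a drop.
excess : ∀ {n s u} {x y x′ y′ : Subset n} → Drop x y x′ y′ s u → ∣ x′ ∣ ≡ (u + s) + ∣ y′ ∣
excess {s = s} {u} d = trans (lower-size d) (trans (cong (u +_) (slack-size d)) (sym (+-assoc u s _)))

slack-unique : ∀ {n s s₁ u} {x y x₁ y₁ x′ y′ : Subset n} →
               Drop x y x′ y′ s u → Drop x₁ y₁ x′ y′ s₁ u → s ≡ s₁
slack-unique {s = s} {s₁} {u} {y′ = y′} d d₁ =
  +-cancelˡ-≡ u s s₁ (+-cancelʳ-≡ ∣ y′ ∣ (u + s) (u + s₁) (trans (sym (excess d)) (excess d₁)))

-- The head column of the result names the constructor, except that a lower ball with nothing above
-- it may come from `close` or from `fall`. The former has positive slack and the latter none, while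
-- the slack is fixed by the result and `u`.
Drop-injective : ∀ {n s s₁ u} {x y x₁ y₁ x′ y′ : Subset n} →
                 Drop x y x′ y′ s u → Drop x₁ y₁ x′ y′ s₁ u → x ≡ x₁ × y ≡ y₁
Drop-injective done done = refl , refl
Drop-injective (neither d) (neither e) with refl , refl ← Drop-injective d e = refl , refl
Drop-injective (both d) (both e) with refl , refl ← Drop-injective d e = refl , refl
Drop-injective (close d) (close e) with refl , refl ← Drop-injective d e = refl , refl
Drop-injective d₀@(close _) e₀@(fall _) with () ← slack-unique d₀ e₀
Drop-injective (match d) (match e) with refl , refl ← Drop-injective d e = refl , refl
Drop-injective d₀@(fall _) e₀@(close _) with () ← slack-unique d₀ e₀
Drop-injective (fall d) (fall e) with refl , refl ← Drop-injective d e = refl , refl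

-- The rightmost u unmatched lower balls are lifted; an unmatched ball in the first column is among
-- them only if u is the whole excess d.
Drop-surjective : ∀ {n} {x′ y′ : Subset n} d u → y′ ≼ x′ → ∣ x′ ∣ ≡ d + ∣ y′ ∣ → u ≤ d →
                  ∃ λ x → ∃ λ y → ∃ λ s → Drop x y x′ y′ s u × u + s ≡ d
Drop-surjective zero zero [] eq _ = [] , [] , 0 , done , refl
Drop-surjective {x′ = false ∷ _} {false ∷ _} d u (_ ∷ y≼x) eq u≤d
  with x , y , s , D , us ← Drop-surjective d u y≼x eq u≤d = _ , _ , _ , neither D , us
Drop-surjective {x′ = true ∷ _} {true ∷ _} d u (_ ∷ y≼x) eq u≤d
  with x , y , s , D , us ← Drop-surjective d u y≼x (suc-injective (trans eq (+-suc d _))) u≤d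
  = _ , _ , _ , both D , us
Drop-surjective {x′ = false ∷ _} {true ∷ _} d u (_ ∷ y≼x) eq u≤d
  with Drop-surjective (suc d) u y≼x (trans eq (+-suc d _)) (m≤n⇒m≤1+n u≤d)
... | x , y , suc s , D , us = _ , _ , _ , match D , suc-injective (trans (sym (+-suc u s)) us)
... | x , y , zero , D , us = ⊥-elim (n≮n d (subst (_≤ d) (trans (sym (+-identityʳ u)) us) u≤d))
Drop-surjective {x′ = true ∷ _} {false ∷ _} zero u (_ ∷ y≼x) eq u≤d =
  ⊥-elim (1+n≰n (≤-trans (≤-reflexive eq) (≼-size y≼x)))
Drop-surjective {x′ = true ∷ _} {false ∷ _} (suc d) u (_ ∷ y≼x) eq u≤d with m≤n⇒m<n∨m≡n u≤d
... | inj₁ (s≤s u≤d′) with x , y , s , D , us ← Drop-surjective d u y≼x (suc-injective eq) u≤d′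
  = _ , _ , _ , close D , trans (+-suc u s) (cong suc us)
... | inj₂ refl with Drop-surjective d d y≼x (suc-injective eq) ≤-refl
...   | x , y , zero , D , us = _ , _ , _ , fall D , cong suc us
...   | x , y , suc s , D , us = ⊥-elim (m≢1+m+n d (trans (sym us) (+-suc d s)))

upper≤lower : ∀ {n s u} {x y x′ y′ : Subset n} → Drop x y x′ y′ s u → ∣ y′ ∣ ≤ ∣ x ∣
upper≤lower {s = s} d = ≤-trans (m≤n+m _ s) (≤-reflexive (sym (slack-size d)))

-- Each suffix of a drop is itself a drop, so `slack-size` applies suffix by suffix: a surviving
-- ball has its partner weakly to the right.
upper≼lower : ∀ {n s u} {x y x′ y′ : Subset n} → Drop x y x′ y′ s u → y′ ≼ x
upper≼lower done            = []
upper≼lower d₀@(neither d)  = upper≤lower d₀ ∷ upper≼lower d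
upper≼lower d₀@(both d)     = upper≤lower d₀ ∷ upper≼lower d
upper≼lower d₀@(close d)    = upper≤lower d₀ ∷ upper≼lower d
upper≼lower d₀@(match d)    = upper≤lower d₀ ∷ upper≼lower d
upper≼lower d₀@(fall d)     = upper≤lower d₀ ∷ upper≼lower d

lower-grows : ∀ {n s u} {x y x′ y′ : Subset n} → Drop x y x′ y′ s u → x ≼ x′
lower-grows done        = []
lower-grows (neither d) with ih ← lower-grows d = ≼-size ih ∷ ih
lower-grows (both d)    with ih ← lower-grows d = s≤s (≼-size ih) ∷ ih
lower-grows (close d)   with ih ← lower-grows d = s≤s (≼-size ih) ∷ ih
lower-grows (match d)   with ih ← lower-grows d = ≼-size ih ∷ ih
lower-grows (fall d)    with ih ← lower-grows d = m≤n⇒m≤1+n (≼-size ih) ∷ ih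

-- If a ball falls from x′ onto a, nothing of a to its right is left unmatched, so there a and x″
-- have equally many balls.
dominates-next : ∀ {n s u t v} {x y x′ y′ a a′ x″ : Subset n} → x ≼ a →
                 Drop x y x′ y′ s u → Drop a x′ a′ x″ t v → x ≼ x″
dominates-next [] done done = []
dominates-next (p ∷ ps) (neither d) (neither e) with ih ← dominates-next ps d e = ≼-size ih ∷ ih
dominates-next (p ∷ ps) (neither d) (close e)   with ih ← dominates-next ps d e = ≼-size ih ∷ ih
dominates-next (p ∷ ps) (both d) (both e)  with ih ← dominates-next ps d e = s≤s (≼-size ih) ∷ ih
dominates-next (p ∷ ps) (both d) (match e) with ih ← dominates-next ps d e = s≤s (≼-size ih) ∷ ih
dominates-next (p ∷ ps) (both d) (fall e)  with ih ← dominates-next ps d e = ≤-trans p (≤-reflexive (slack-size e)) ∷ ih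
dominates-next (p ∷ ps) (close d) (both e)  with ih ← dominates-next ps d e = s≤s (≼-size ih) ∷ ih
dominates-next (p ∷ ps) (close d) (match e) with ih ← dominates-next ps d e = s≤s (≼-size ih) ∷ ih
dominates-next (p ∷ ps) (close d) (fall e)  with ih ← dominates-next ps d e = ≤-trans p (≤-reflexive (slack-size e)) ∷ ih
dominates-next (p ∷ ps) (match d) (neither e) with ih ← dominates-next ps d e = ≼-size ih ∷ ih
dominates-next (p ∷ ps) (match d) (close e)   with ih ← dominates-next ps d e = ≼-size ih ∷ ih
dominates-next (p ∷ ps) (fall d) (both e)  with ih ← dominates-next ps d e = m≤n⇒m≤1+n (≼-size ih) ∷ ih
dominates-next (p ∷ ps) (fall d) (match e) with ih ← dominates-next ps d e = m≤n⇒m≤1+n (≼-size ih) ∷ ih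
dominates-next (p ∷ ps) (fall d) (fall e)  with ih ← dominates-next ps d e = ≤-trans p (≤-reflexive (slack-size e)) ∷ ih

-- The analogue of dominates-next for undoing two successive drops.
lifted≼upper : ∀ {n s u t v} {x y x′ y′ w y″ z : Subset n} →
               Drop w z y y″ t v → Drop x y x′ y′ s u → y″ ≼ y′ → ∣ w ∣ ≤ ∣ y′ ∣ → w ≼ y′
lifted≼upper done done [] h = []
lifted≼upper (neither e) (neither d) (_ ∷ p) h = h ∷ lifted≼upper e d p h
lifted≼upper (neither e) (close d)   (_ ∷ p) h = h ∷ lifted≼upper e d p h
lifted≼upper (both e)    (both d)    (_ ∷ p) h = h ∷ lifted≼upper e d p (s≤s⁻¹ h)
lifted≼upper (both e)    (match d)   (_ ∷ p) h = h ∷ lifted≼upper e d p (s≤s⁻¹ h)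
lifted≼upper (both e)    (fall d)    (_ ∷ p) h = h ∷ lifted≼upper e d p (<⇒≤ h)
lifted≼upper (close e)   (both d)    (_ ∷ p) h = h ∷ lifted≼upper e d p (s≤s⁻¹ h)
lifted≼upper (close e)   (match d)   (_ ∷ p) h = h ∷ lifted≼upper e d p (s≤s⁻¹ h)
lifted≼upper (close e)   (fall d)    (_ ∷ p) h = h ∷ lifted≼upper e d p (<⇒≤ h)
lifted≼upper (match e)   (neither d) (_ ∷ p) h = h ∷ lifted≼upper e d p h
lifted≼upper (match e)   (close d)   (_ ∷ p) h = h ∷ lifted≼upper e d p h
lifted≼upper (fall e)    (both d)    (_ ∷ p) h =
  h ∷ lifted≼upper e d p (≤-trans (≤-reflexive (slack-size e)) (≼-size p))
lifted≼upper (fall e)    (match d)   (_ ∷ p) h =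
  h ∷ lifted≼upper e d p (≤-trans (≤-reflexive (slack-size e)) (≼-size p))
lifted≼upper (fall e)    (fall d)    (_ ∷ p) h =
  h ∷ lifted≼upper e d p (≤-trans (≤-reflexive (slack-size e)) (≼-size p))

upper-shrinks : ∀ {n s u} {x y x′ y′ : Subset n} → Drop x y x′ y′ s u → y′ ≼ y
upper-shrinks done        = []
upper-shrinks (neither d) with ih ← upper-shrinks d = ≼-size ih ∷ ih
upper-shrinks (both d)    with ih ← upper-shrinks d = s≤s (≼-size ih) ∷ ih
upper-shrinks (close d)   with ih ← upper-shrinks d = ≼-size ih ∷ ih
upper-shrinks (match d)   with ih ← upper-shrinks d = s≤s (≼-size ih) ∷ ih
upper-shrinks (fall d)    with ih ← upper-shrinks d = m≤n⇒m≤1+n (≼-size ih) ∷ ih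

Drop-functional : ∀ {n s s₁ u u₁} {x y x′ y′ x₁ y₁ : Subset n} →
                  Drop x y x′ y′ s u → Drop x y x₁ y₁ s₁ u₁ → s ≡ s₁ × x′ ≡ x₁ × y′ ≡ y₁
Drop-functional done done = refl , refl , refl
Drop-functional (neither d) (neither e) with refl , refl , refl ← Drop-functional d e = refl , refl , refl
Drop-functional (both d) (both e)       with refl , refl , refl ← Drop-functional d e = refl , refl , refl
Drop-functional (close d) (close e)     with refl , refl , refl ← Drop-functional d e = refl , refl , refl
Drop-functional (match d) (match e)     with refl , refl , refl ← Drop-functional d e = refl , refl , refl
Drop-functional (fall d) (fall e)       with refl , refl , refl ← Drop-functional d e = refl , refl , refl
Drop-functional (match d) (fall e)      with () , _ ← Drop-functional d e
Drop-functional (fall d) (match e)      with () , _ ← Drop-functional d e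

-- The operators as functions on lists of rows

-- `pred` covers both fates of a lone upper ball: it takes a partner if the slack is positive, and
-- otherwise falls and leaves the slack at 0.
slack : ∀ {n} → Subset n → Subset n → ℕ
slack []          []          = 0
slack (false ∷ x) (false ∷ y) = slack x y
slack (true ∷ x)  (true ∷ y)  = slack x y
slack (true ∷ x)  (false ∷ y) = suc (slack x y)
slack (false ∷ x) (true ∷ y)  = pred (slack x y)

fallen : ∀ {n} → Subset n → Subset n → Subset n
fallen []          []          = []
fallen (false ∷ x) (true ∷ y)  = (slack x y ≡ᵇ 0) ∷ fallen x y
fallen (false ∷ x) (false ∷ y) = false ∷ fallen x y
fallen (true ∷ x)  (_ ∷ y)     = false ∷ fallen x y

Drop-total : ∀ {n} (x y : Subset n) →
             Drop x y (x ∪ fallen x y) (y ∩ ∁ (fallen x y)) (slack x y) ∣ fallen x y ∣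
Drop-total []          []          = done
Drop-total (false ∷ x) (false ∷ y) = neither (Drop-total x y)
Drop-total (true ∷ x)  (true ∷ y)  = both (Drop-total x y)
Drop-total (true ∷ x)  (false ∷ y) = close (Drop-total x y)
Drop-total (false ∷ x) (true ∷ y) with slack x y | Drop-total x y
... | zero  | d = fall d
... | suc s | d = match d

-- Indices start at 0: `dropAt i` plays the part of `e⋆ (suc i)` on a list of rows, bottom row
-- first.
dropAt : ∀ {n} → ℕ → List (Subset n) → List (Subset n)
dropAt zero    (x ∷ y ∷ rows) = (x ∪ fallen x y) ∷ (y ∩ ∁ (fallen x y)) ∷ rows
dropAt zero    rows           = rows
dropAt (suc i) []             = []
dropAt (suc i) (x ∷ rows)     = x ∷ dropAt i rows

-- A round `e⋆[1, k ]` applies `e⋆ k` first and `e⋆ 1` last, so the upper rows are dealt with before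
-- the lowest pair.
insertRow : ∀ {n} → List (Subset n) → Subset n → List (Subset n)
insertRow []       y = y ∷ []
insertRow (x ∷ xs) y = dropAt 0 (x ∷ insertRow xs y)

-- The graph of `insertRow`, which exposes the slack and the number of fallen balls at each height
-- and can be read backwards.
data Insert {n} : List (Subset n) → Subset n → List (Subset n) → Set where
  [_]  : ∀ y → Insert [] y (y ∷ [])
  _∷_ : ∀ {xs y z zs x x′ z′ s u} → Drop x z x′ z′ s u → Insert xs y (z ∷ zs) →
        Insert (x ∷ xs) y (x′ ∷ z′ ∷ zs)

Insert-total : ∀ {n} (xs : List (Subset n)) y → Insert xs y (insertRow xs y)
Insert-total []       y = [ y ]
Insert-total (x ∷ xs) y with insertRow xs y | Insert-total xs y
... | z ∷ zs | ins = Drop-total x z ∷ ins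

Insert-functional : ∀ {n} {xs : List (Subset n)} {y N} → Insert xs y N → insertRow xs y ≡ N
Insert-functional [ y ] = refl
Insert-functional {xs = x ∷ _} (_∷_ {z = z} d ins) rewrite Insert-functional ins
  with _ , refl , refl ← Drop-functional d (Drop-total x z) = refl

sizes : ∀ {n} → List (Subset n) → List ℕ
sizes = map ∣_∣

-- The sizes before and after tell how many balls fell at each height; then each drop can be undone
-- in one way only.
Insert-injective : ∀ {n} {xs xs₁ : List (Subset n)} {y y₁ N} → Insert xs y N → Insert xs₁ y₁ N →
                   sizes xs ≡ sizes xs₁ → xs ≡ xs₁ × y ≡ y₁
Insert-injective [ y ] [ .y ] _ = refl , refl
Insert-injective (_∷_ {x = x} {u = u} d ins) (_∷_ {x = x₁} {u = u₁} e ins₁) eq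
  with |x|≡ , eqs ← ∷-injective eq
  with refl ← +-cancelʳ-≡ ∣ x ∣ u u₁ (trans (sym (lower-size d)) (trans (lower-size e) (cong (u₁ +_) (sym |x|≡))))
  with refl , refl ← Drop-injective d e
  with refl , refl ← Insert-injective ins ins₁ eqs = refl , refl

Nested : ∀ {n} → List (Subset n) → Set
Nested = Linked (λ x y → y ≼ x)

Nested-grow : ∀ {n} {x y : Subset n} {N} → Nested (x ∷ N) → x ≼ y → Nested (y ∷ N)
Nested-grow [-]      _   = [-]
Nested-grow (q ∷ qs) x≼y = ≼-trans q x≼y ∷ qs

infix 4 _⋉_

-- New and old rows alternate in a single chain of dominations that starts and ends with a new row.
-- `Interlace` is its shadow on sizes: consecutive shapes differ by a horizontal strip.
data _⋉_ {n} : List (Subset n) → List (Subset n) → Set where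
  [_]   : ∀ y → (y ∷ []) ⋉ []
  ⟨_,_⟩∷_ : ∀ {x′ x z N xs} → x ≼ x′ → z ≼ x → (z ∷ N) ⋉ xs → (x′ ∷ z ∷ N) ⋉ (x ∷ xs)

⋉⇒Nested : ∀ {n} {N xs : List (Subset n)} → N ⋉ xs → Nested N
⋉⇒Nested [ y ] = [-]
⋉⇒Nested (⟨ x≼x′ , z≼x ⟩∷ r) = ≼-trans z≼x x≼x′ ∷ ⋉⇒Nested r

Insert⇒⋉ : ∀ {n} {xs : List (Subset n)} {y N} → Nested xs → Insert xs y N → N ⋉ xs
Insert⇒⋉ _ [ y ] = [ y ]
Insert⇒⋉ _ (d ∷ [ y ]) = ⟨ lower-grows d , upper≼lower d ⟩∷ [ _ ]
-- The second row gained balls in `d` and lost some in `e`. Its lower bound in the induction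
-- hypothesis predates the loss, so it is discarded in favour of the one from `dominates-next`.
Insert⇒⋉ (p ∷ ps) (e ∷ (d ∷ ins)) with ⟨ _ , z≼x ⟩∷ r ← Insert⇒⋉ ps (d ∷ ins) =
  ⟨ lower-grows e , upper≼lower e ⟩∷ ⟨ dominates-next p d e , z≼x ⟩∷ r

data Interlace : List ℕ → List ℕ → Set where
  [_]   : ∀ a → Interlace (a ∷ []) []
  ⟨_,_⟩∷_ : ∀ {a b p c′ c} → p ≤ a → b ≤ p → Interlace (b ∷ c′) c → Interlace (a ∷ b ∷ c′) (p ∷ c)

⋉⇒Interlace : ∀ {n} {N xs : List (Subset n)} → N ⋉ xs → Interlace (sizes N) (sizes xs)
⋉⇒Interlace [ y ] = [ _ ]
⋉⇒Interlace (⟨ p , q ⟩∷ r) = ⟨ ≼-size p , ≼-size q ⟩∷ ⋉⇒Interlace r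

Interlace-grow : ∀ {a b c′ c} → a ≤ b → Interlace (a ∷ c′) c → Interlace (b ∷ c′) c
Interlace-grow _   [ _ ]           = [ _ ]
Interlace-grow a≤b (⟨ p , q ⟩∷ r) = ⟨ ≤-trans p a≤b , q ⟩∷ r

-- Drops are undone from the bottom up. Lifting balls out of the lowest row enlarges the next one,
-- which then heads a shorter problem; enlarging a head harms neither nestedness nor interlacing.
Insert-surjective : ∀ {n} (N : List (Subset n)) c → Nested N → Interlace (sizes N) c →
                    ∃ λ xs → ∃ λ y → Insert xs y N × sizes xs ≡ c × Nested xs
Insert-surjective (y ∷ []) .[] _ [ _ ] = [] , y , [ y ] , refl , []
Insert-surjective (x′ ∷ z′ ∷ zs) (p ∷ c) (z′≼x′ ∷ N) (⟨ p≤x′ , z′≤p ⟩∷ r)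
  -- Exactly `∣ x′ ∣ ∸ p` balls must have fallen, and `z′≤p` keeps this within the visible excess
  -- `∣ x′ ∣ ∸ ∣ z′ ∣`.
  with x , z , _ , d , _ ← Drop-surjective (∣ x′ ∣ ∸ ∣ z′ ∣) (∣ x′ ∣ ∸ p) z′≼x′
                             (sym (m∸n+n≡m (≼-size z′≼x′))) (∸-monoʳ-≤ ∣ x′ ∣ z′≤p)
  with xs , y , ins , refl , Nxs ← Insert-surjective (z ∷ zs) c (Nested-grow N (upper-shrinks d))
                                     (Interlace-grow (≼-size (upper-shrinks d)) r)
  = x ∷ xs , y , d ∷ ins , cong (_∷ _) |x|≡p , nested ins Nxs N r
  where
  |x|≡p : ∣ x ∣ ≡ p
  |x|≡p = +-cancelˡ-≡ (∣ x′ ∣ ∸ p) _ _ (trans (sym (lower-size d)) (sym (m∸n+n≡m p≤x′)))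
  nested : ∀ {xs y zs} → Insert xs y (z ∷ zs) → Nested xs → Nested (z′ ∷ zs) →
           Interlace (∣ z′ ∣ ∷ sizes zs) (sizes xs) → Nested (x ∷ xs)
  nested [ _ ] _ _ _ = [-]
  -- The restored row above is dominated even by `z′`, the row before its enlargement; for this the
  -- interlacing of the original sizes is kept.
  nested (e ∷ _) Nxs (q ∷ _) (⟨ w≤z′ , _ ⟩∷ _) =
    ≼-trans (lifted≼upper e d q w≤z′) (upper≼lower d) ∷ Nxs

-- The column word

-- unmatchedAbove and members loop through functions local to their definitions.  Abstracting the initial
-- arguments in a defining equation lets unification give those functions a name.
mutual
  scan : ∀ {n} → ℕ → List (ℕ × Fin n) → List (ℕ × Fin n) → List (Fin n) → List (Fin n)
  scan = _

  scan-def : ∀ {n} i (j : Fin n) w → unmatchedAbove (suc i) ((0 , j) ∷ w) ≡ scan i ((0 , j) ∷ w) w []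
  scan-def {n} i j w with (0 , j) ∷ w | List.[] {A = Fin n}
  ... | _ | _ = refl

popIf : ∀ {A : Set} → Bool → List A → List A
popIf b st = if b then drop 1 st else st

pushIf : ∀ {A : Set} → Bool → A → List A → List A
pushIf b j st = if b then j ∷ st else st

-- Row indices start at 0 and letters at 1: the lower row `i` writes `suc i`, the upper row
-- `suc (suc i)`.
step : ∀ {n} → ℕ → List (Fin n) → ℕ × Fin n → List (Fin n)
step i st (r , j) = if r ≡ᵇ suc (suc i) then j ∷ st else popIf (r ≡ᵇ suc i) st

scan-foldl : ∀ {n} i w₀ w (st : List (Fin n)) → scan i w₀ w st ≡ foldl (step i) st w
scan-foldl i w₀ []            st = refl
scan-foldl i w₀ ((r , j) ∷ w) st with r ≡ᵇ suc (suc i)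
... | true = scan-foldl i w₀ w (j ∷ st)
... | false with r ≡ᵇ suc i | st
...   | true  | []      = scan-foldl i w₀ w []
...   | true  | _ ∷ st′ = scan-foldl i w₀ w st′
...   | false | st′     = scan-foldl i w₀ w st′

foldl-concatMap : ∀ {A B S : Set} (f : S → B → S) (g : A → List B) s xs →
                  foldl f s (concatMap g xs) ≡ foldl (λ s x → foldl f s (g x)) s xs
foldl-concatMap f g s []       = refl
foldl-concatMap f g s (x ∷ xs) =
  trans (foldl-++ f s (g x) (concatMap g xs)) (foldl-concatMap f g (foldl f s (g x)) xs)

module _ {A S : Set} (h : A → S → S) where

  foldr-tabulate-id : ∀ {m} (φ : Fin m → A) s → (∀ r s → h (φ r) s ≡ s) → foldr h s (tabulate φ) ≡ s
  foldr-tabulate-id {zero}  φ s inert = refl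
  foldr-tabulate-id {suc m} φ s inert = trans (inert zero _) (foldr-tabulate-id (φ ∘ suc) s (inert ∘ suc))

  -- Meant for one column, where the letters of all but two rows leave the stack alone. Reading from
  -- top to bottom is a `foldr` over the rows listed from the bottom, hence the upper row `b` acts
  -- first.
  foldr-tabulate-two : ∀ {m} (φ : Fin m → A) s {i} (a b : Fin m) → toℕ a ≡ i → toℕ b ≡ suc i →
                       (∀ r s → toℕ r ≢ i → toℕ r ≢ suc i → h (φ r) s ≡ s) →
                       foldr h s (tabulate φ) ≡ h (φ a) (h (φ b) s)
  foldr-tabulate-two φ s zero (suc zero) refl refl inert =
    cong (h (φ zero) ∘ h (φ (suc zero)))
      (foldr-tabulate-id (λ r → φ (suc (suc r))) s λ r s → inert (suc (suc r)) s (λ ()) (λ ()))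
  foldr-tabulate-two φ s (suc a) (suc b) refl eq inert =
    trans (inert zero _ (λ ()) (λ ()))
      (foldr-tabulate-two (φ ∘ suc) s a b refl (suc-injective eq)
        λ r s r≢a r≢b → inert (suc r) s (r≢a ∘ suc-injective) (r≢b ∘ suc-injective))

read : ∀ {A : Set} {m} → (Fin m → A) → Subset m → Subset m → List A → List A
read φ []      []      st = st
read φ (a ∷ x) (b ∷ y) st = read (φ ∘ suc) x y (popIf a (pushIf b (φ zero) st))

foldl-read : ∀ {A : Set} {m} (X Y : A → Bool) (φ : Fin m → A) st →
             foldl (λ st j → popIf (X j) (pushIf (Y j) j st)) st (tabulate φ) ≡
             read φ (Vec.tabulate (X ∘ φ)) (Vec.tabulate (Y ∘ φ)) st
foldl-read {m = zero}  X Y φ st = refl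
foldl-read {m = suc m} X Y φ st = foldl-read X Y (φ ∘ suc) _

-- Rightmost first, as the last ball read lies on top of the stack.
elements : ∀ {A : Set} {m} → (Fin m → A) → Subset m → List A
elements φ []      = []
elements φ (b ∷ f) = elements (φ ∘ suc) f ++ (if b then φ zero ∷ [] else [])

-- The unmatched closing letters of `x` remove `slack x y` entries of whatever stack they meet, and
-- the fallen balls come to lie above the rest. The stack is arbitrary because the tail is read with
-- a changed one.
read-fallen : ∀ {A : Set} {m} (φ : Fin m → A) x y st →
              read φ x y st ≡ elements φ (fallen x y) ++ drop (slack x y) st
read-fallen φ [] [] st = refl
read-fallen φ (false ∷ x) (false ∷ y) st
  rewrite ++-identityʳ (elements (φ ∘ suc) (fallen x y)) = read-fallen (φ ∘ suc) x y st
read-fallen φ (true ∷ x) (true ∷ y) st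
  rewrite ++-identityʳ (elements (φ ∘ suc) (fallen x y)) = read-fallen (φ ∘ suc) x y st
read-fallen φ (true ∷ x) (false ∷ y) st
  rewrite ++-identityʳ (elements (φ ∘ suc) (fallen x y)) | sym (drop-drop 1 (slack x y) st) =
  read-fallen (φ ∘ suc) x y (drop 1 st)
-- The ball of the first column lies on top of `st`; the tail removes it precisely when its slack is
-- positive.
read-fallen φ (false ∷ x) (true ∷ y) st with slack x y | read-fallen (φ ∘ suc) x y (φ zero ∷ st)
... | zero  | ih = trans ih (sym (++-assoc (elements (φ ∘ suc) (fallen x y)) _ _))
... | suc s | ih rewrite ++-identityʳ (elements (φ ∘ suc) (fallen x y)) = ih

elements-map : ∀ {A B : Set} {m} (ψ : A → B) (φ : Fin m → A) f → elements (ψ ∘ φ) f ≡ map ψ (elements φ f)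
elements-map ψ φ []          = refl
elements-map ψ φ (true ∷ f)  rewrite elements-map ψ (φ ∘ suc) f = sym (map-++ ψ (elements (φ ∘ suc) f) _)
elements-map ψ φ (false ∷ f) rewrite elements-map ψ (φ ∘ suc) f = sym (map-++ ψ (elements (φ ∘ suc) f) _)

toSubset-map-suc : ∀ {m} (us : List (Fin m)) b →
                   toSubset (map suc us ++ (if b then zero ∷ [] else [])) ≡ b ∷ toSubset us
toSubset-map-suc []       true  = cong (true ∷_) (∪-identityʳ _)
toSubset-map-suc []       false = refl
toSubset-map-suc (u ∷ us) b     = cong (⁅ suc u ⁆ ∪_) (toSubset-map-suc us b)

toSubset-elements : ∀ {m} (f : Subset m) → toSubset (elements id f) ≡ f
toSubset-elements []      = refl
toSubset-elements (b ∷ f) =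
  trans (cong (λ us → toSubset (us ++ (if b then zero ∷ [] else []))) (elements-map suc id f))
    (trans (toSubset-map-suc (elements id f) b) (cong (b ∷_) (toSubset-elements f)))

≢⇒≡ᵇ-false : ∀ {m n} → m ≢ n → (m ≡ᵇ n) ≡ false
≢⇒≡ᵇ-false {m} {n} = dec-false (m ≟ n)

≡ᵇ-refl : ∀ n → (n ≡ᵇ n) ≡ true
≡ᵇ-refl n = dec-true (n ≟ n) refl

module _ {L n} (B : BallSystem L n) where

  letter : Fin n → Fin L → List (ℕ × Fin n)
  letter j r = if lookup (lookup B r) j then (suc (toℕ r) , j) ∷ [] else []

  readRow : ℕ → Fin n → Fin L → List (Fin n) → List (Fin n)
  readRow i j r st = foldl (step i) st (letter j r)

  readRow-inert : ∀ i j r st → toℕ r ≢ i → toℕ r ≢ suc i → readRow i j r st ≡ st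
  readRow-inert i j r st r≢i r≢1+i with lookup (lookup B r) j
  ... | false = refl
  ... | true rewrite ≢⇒≡ᵇ-false r≢i | ≢⇒≡ᵇ-false r≢1+i = refl

  readRow-lower : ∀ j r st → readRow (toℕ r) j r st ≡ popIf (lookup (lookup B r) j) st
  readRow-lower j r st with lookup (lookup B r) j
  ... | false = refl
  ... | true rewrite ≢⇒≡ᵇ-false (1+n≢n {toℕ r} ∘ sym) | ≡ᵇ-refl (toℕ r) = refl

  readRow-upper : ∀ i j r st → toℕ r ≡ suc i → readRow i j r st ≡ pushIf (lookup (lookup B r) j) j st
  readRow-upper i j r st eq with lookup (lookup B r) j
  ... | false = refl
  ... | true rewrite eq | ≡ᵇ-refl i = refl

  scan-column : ∀ {i} a b → toℕ a ≡ i → toℕ b ≡ suc i → ∀ st j →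
                foldl (step i) st (concatMap (letter j) (reverse (allFin L))) ≡
                popIf (lookup (lookup B a) j) (pushIf (lookup (lookup B b) j) j st)
  scan-column {i} a b refl eqb st j =
    trans (foldl-concatMap (step i) (letter j) st (reverse (allFin L)))
    (trans (reverse-foldl (λ s r → readRow i j r s) st (allFin L))
    (trans (foldr-tabulate-two (readRow i j) id st a b refl eqb λ r s → readRow-inert i j r s)
    (trans (readRow-lower j a _) (cong (popIf (lookup (lookup B a) j)) (readRow-upper i j b st eqb)))))

  toSubset-unmatched : ∀ {i} a b → toℕ a ≡ i → toℕ b ≡ suc i →
                       toSubset (unmatchedAbove (suc i) (cw B)) ≡ fallen (lookup B a) (lookup B b)
  toSubset-unmatched {i} a b eqa eqb = trans (cong toSubset eq) (toSubset-elements (fallen x y))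
    where
    x = lookup B a
    y = lookup B b
    open ≡-Reasoning
    eq : unmatchedAbove (suc i) (cw B) ≡ elements id (fallen x y)
    eq = begin
      unmatchedAbove (suc i) (cw B)
        ≡⟨ scan-foldl i (cw B) (cw B) [] ⟩
      foldl (step i) [] (cw B)
        ≡⟨ foldl-concatMap (step i) (λ j → concatMap (letter j) (reverse (allFin L))) [] (allFin n) ⟩
      foldl (λ st j → foldl (step i) st (concatMap (letter j) (reverse (allFin L)))) [] (allFin n)
        ≡⟨ foldl-cong (scan-column a b eqa eqb) [] (allFin n) ⟩
      foldl (λ st j → popIf (lookup x j) (pushIf (lookup y j) j st)) [] (allFin n)
        ≡⟨ foldl-read (lookup x) (lookup y) id [] ⟩
      read id (Vec.tabulate (lookup x)) (Vec.tabulate (lookup y)) []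
        ≡⟨ cong₂ (λ x y → read id x y []) (tabulate∘lookup x) (tabulate∘lookup y) ⟩
      read id x y []
        ≡⟨ read-fallen id x y [] ⟩
      elements id (fallen x y) ++ drop (slack x y) []
        ≡⟨ cong (elements id (fallen x y) ++_) (drop-[] (slack x y)) ⟩
      elements id (fallen x y) ++ []
        ≡⟨ ++-identityʳ _ ⟩
      elements id (fallen x y) ∎

-- The local row function of `e⋆` with the set `U` as a parameter, so that `U` can be replaced by an
-- equal set.
moveDown : ∀ {L n} → ℕ → Subset n → BallSystem L n → Fin L → Subset n
moveDown i U B r = if toℕ r ≡ᵇ suc i then lookup B r ∩ ∁ U
                   else if suc (toℕ r) ≡ᵇ suc i then lookup B r ∪ U
                   else lookup B r

moveDown-dropAt : ∀ {L n} i (B : BallSystem L n) a b → toℕ a ≡ i → toℕ b ≡ suc i →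
                  toList (Vec.tabulate (moveDown i (fallen (lookup B a) (lookup B b)) B)) ≡ dropAt i (toList B)
moveDown-dropAt zero (x ∷ y ∷ B) zero (suc zero) refl refl =
  cong (λ B → x ∪ fallen x y ∷ y ∩ ∁ (fallen x y) ∷ toList B) (tabulate∘lookup B)
moveDown-dropAt (suc i) (x ∷ B) (suc a) (suc b) eqa eqb =
  cong (x ∷_) (moveDown-dropAt i B a b (suc-injective eqa) (suc-injective eqb))

e⋆-dropAt : ∀ {L n} i (B : BallSystem L n) → suc i < L → toList (e⋆ (suc i) B) ≡ dropAt i (toList B)
e⋆-dropAt i B i<L =
  trans (cong (λ U → toList (Vec.tabulate (moveDown i U B))) (toSubset-unmatched B a b eqa eqb))
        (moveDown-dropAt i B a b eqa eqb)
  where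
  a = fromℕ< (<⇒≤ i<L)
  b = fromℕ< i<L
  eqa = toℕ-fromℕ< (<⇒≤ i<L)
  eqb = toℕ-fromℕ< i<L

dropFrom : ∀ {n} → ℕ → List (Subset n) → List (Subset n)
dropFrom zero    rows = rows
dropFrom (suc k) rows = dropFrom k (dropAt k rows)

-- Only the last of the operators touches the bottom row.
dropFrom-∷ : ∀ {n} k (x : Subset n) rows → dropFrom (suc k) (x ∷ rows) ≡ dropAt 0 (x ∷ dropFrom k rows)
dropFrom-∷ zero    x rows = refl
dropFrom-∷ (suc k) x rows = dropFrom-∷ k x (dropAt k rows)

insertRow-length : ∀ {n} (xs : List (Subset n)) y → length (insertRow xs y) ≡ suc (length xs)
insertRow-length []       y = refl
insertRow-length (x ∷ xs) y with insertRow xs y | insertRow-length xs y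
... | z ∷ zs | eq = cong suc eq

dropFrom-insertRow : ∀ {n} (xs : List (Subset n)) y rows →
                     dropFrom (length xs) (xs ++ y ∷ rows) ≡ insertRow xs y ++ rows
dropFrom-insertRow []       y rows = refl
dropFrom-insertRow (x ∷ xs) y rows =
  trans (dropFrom-∷ (length xs) x (xs ++ y ∷ rows))
        (trans (cong (λ r → dropAt 0 (x ∷ r)) (dropFrom-insertRow xs y rows)) dropAt-++)
  where
  dropAt-++ : dropAt 0 (x ∷ insertRow xs y ++ rows) ≡ insertRow (x ∷ xs) y ++ rows
  -- An insertion is never empty, so the row above `x` comes from it and not from `rows`.
  dropAt-++ with insertRow xs y | insertRow-length xs y
  ... | z ∷ zs | _ = refl

e⋆[1,]-dropFrom : ∀ {L n} k (B : BallSystem L n) → k < L → toList (e⋆[1, k ] B) ≡ dropFrom k (toList B)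
e⋆[1,]-dropFrom zero    B _   = refl
e⋆[1,]-dropFrom (suc k) B k<L =
  trans (e⋆[1,]-dropFrom k (e⋆ (suc k) B) (<⇒≤ k<L)) (cong (dropFrom k) (e⋆-dropAt k B k<L))

-- The map `ρN` as repeated insertion

collapse : ∀ {n} → List (Subset n) → List (Subset n)
collapse = foldl insertRow []

foldl-insertRow-length : ∀ {n} (acc rows : List (Subset n)) →
                         length (foldl insertRow acc rows) ≡ length acc + length rows
foldl-insertRow-length acc []         = sym (+-identityʳ _)
foldl-insertRow-length acc (r ∷ rows) =
  trans (foldl-insertRow-length (insertRow acc r) rows)
        (trans (cong (_+ length rows) (insertRow-length acc r)) (sym (+-suc _ _)))

take-∷ʳ : ∀ {A : Set} k (rows : List A) → k < length rows →
          ∃ λ y → take (suc k) rows ≡ take k rows ∷ʳ y × drop k rows ≡ y ∷ drop (suc k) rows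
take-∷ʳ zero    (r ∷ rows) _         = r , refl , refl
take-∷ʳ (suc k) (r ∷ rows) (s≤s k<) with y , eq , eq′ ← take-∷ʳ k rows k< = y , cong (r ∷_) eq , eq′

-- Each round inserts one more row and leaves those above it alone. `pre k` amounts to `suc k`
-- insertions, since inserting the bottom row into nothing needs no operator.
pre-collapse : ∀ {L n} k (B : BallSystem L n) → k < L →
               toList (pre k B) ≡ collapse (take (suc k) (toList B)) ++ drop (suc k) (toList B)
pre-collapse zero    (x ∷ B) _   = refl
pre-collapse {L} (suc k) B k<L
  with y , take≡ , drop≡ ← take-∷ʳ (suc k) (toList B) (subst (suc k <_) (sym (length-toList B)) k<L) = begin
    toList (e⋆[1, suc k ] (pre k B))
      ≡⟨ e⋆[1,]-dropFrom (suc k) (pre k B) k<L ⟩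
    dropFrom (suc k) (toList (pre k B))
      ≡⟨ cong (dropFrom (suc k)) (pre-collapse k B (<⇒≤ k<L)) ⟩
    dropFrom (suc k) (xs ++ drop (suc k) rows)
      ≡⟨ cong₂ (λ m r → dropFrom m (xs ++ r)) (sym |xs|) drop≡ ⟩
    dropFrom (length xs) (xs ++ y ∷ drop (suc (suc k)) rows)
      ≡⟨ dropFrom-insertRow xs y _ ⟩
    insertRow xs y ++ drop (suc (suc k)) rows
      ≡⟨ cong (_++ drop (suc (suc k)) rows) (sym (trans (cong collapse take≡) (foldl-∷ʳ insertRow [] y (take (suc k) rows)))) ⟩
    collapse (take (suc (suc k)) rows) ++ drop (suc (suc k)) rows ∎
  where
  open ≡-Reasoning
  rows = toList B
  xs = collapse (take (suc k) rows)
  |xs| : length xs ≡ suc k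
  |xs| = trans (foldl-insertRow-length [] (take (suc k) rows))
    (trans (length-take (suc k) rows) (m≤n⇒m⊓n≡m (<⇒≤ (subst (suc k <_) (sym (length-toList B)) k<L))))

ρN-collapse : ∀ {L n} (B : BallSystem L n) → toList (ρN B) ≡ collapse (toList B)
ρN-collapse []           = refl
ρN-collapse {suc L} B@(_ ∷ _) =
  trans (pre-collapse L B ≤-refl)
  (trans (cong₂ (λ a b → collapse a ++ b) (take-all (suc L) (toList B) long) (drop-all (suc L) (toList B) long))
         (++-identityʳ _))
  where
  long : length (toList B) ≤ suc L
  long = ≤-reflexive (length-toList B)

-- Weights

mutual
  select : ∀ {n} → Subset n → List (Fin n) → List (Fin n)
  select = _

  select-def : ∀ {n} (R : Subset n) → members R ≡ select R (allFin n)
  select-def {n} R with allFin n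
  ... | _ = refl

select-map-suc : ∀ {n} b (R : Subset n) js → select (b ∷ R) (map suc js) ≡ map suc (select R js)
select-map-suc b R []       = refl
select-map-suc b R (j ∷ js) with lookup R j
... | true  = cong (suc j ∷_) (select-map-suc b R js)
... | false = select-map-suc b R js

members-∷ : ∀ {n} b (R : Subset n) → members (b ∷ R) ≡ (if b then zero ∷ [] else []) ++ map suc (members R)
members-∷ {n} b R = trans (head b) (cong ((if b then zero ∷ [] else []) ++_) tail)
  where
  head : ∀ b → select (b ∷ R) (allFin (suc n)) ≡ (if b then zero ∷ [] else []) ++ select (b ∷ R) (tabulate suc)
  head true  = refl
  head false = refl
  tail : select (b ∷ R) (tabulate suc) ≡ map suc (select R (allFin n))
  tail = trans (cong (select (b ∷ R)) (sym (map-tabulate id suc))) (select-map-suc b R (allFin n))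

module _ {c ℓ} (M : CommutativeMonoid c ℓ) where
  open CommutativeMonoid M renaming (refl to ≈-refl; sym to ≈-sym; trans to ≈-trans; reflexive to ≈-reflexive)
  open CommutativeSemigroupProperties commutativeSemigroup using (x∙yz≈y∙xz; interchange)
  open SetoidReasoning setoid

  rowWeight : ∀ {n} → (Fin n → Carrier) → Subset n → Carrier
  rowWeight x R = foldr (λ j acc → x j ∙ acc) ε (members R)

  rowWeight-∷ : ∀ {n} (x : Fin (suc n) → Carrier) b (R : Subset n) →
                rowWeight x (b ∷ R) ≡ (if b then x zero ∙ rowWeight (x ∘ suc) R else rowWeight (x ∘ suc) R)
  rowWeight-∷ x true  R = trans (cong (foldr (λ j acc → x j ∙ acc) ε) (members-∷ true R))
                                (cong (x zero ∙_) (foldr-map _ suc ε (members R)))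
  rowWeight-∷ x false R = trans (cong (foldr (λ j acc → x j ∙ acc) ε) (members-∷ false R))
                                (foldr-map _ suc ε (members R))

  -- Every constructor preserves the number of balls in its column; in `fall` the factor of that
  -- column passes from the upper row to the lower.
  Drop-weight : ∀ {n s u} (w : Fin n → Carrier) {x y x′ y′ : Subset n} → Drop x y x′ y′ s u →
                rowWeight w x′ ∙ rowWeight w y′ ≈ rowWeight w x ∙ rowWeight w y
  Drop-weight w done = ≈-refl
  Drop-weight w (neither {x = x} {y} {x′} {y′} d)
    rewrite rowWeight-∷ w false x | rowWeight-∷ w false y | rowWeight-∷ w false x′ | rowWeight-∷ w false y′ =
    Drop-weight (w ∘ suc) d
  Drop-weight w (both {x = x} {y} {x′} {y′} d)
    rewrite rowWeight-∷ w true x | rowWeight-∷ w true y | rowWeight-∷ w true x′ | rowWeight-∷ w true y′ =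
    ≈-trans (interchange _ _ _ _) (≈-trans (∙-congˡ (Drop-weight (w ∘ suc) d)) (interchange _ _ _ _))
  Drop-weight w (close {x = x} {y} {x′} {y′} d)
    rewrite rowWeight-∷ w true x | rowWeight-∷ w false y | rowWeight-∷ w true x′ | rowWeight-∷ w false y′ =
    ≈-trans (assoc _ _ _) (≈-trans (∙-congˡ (Drop-weight (w ∘ suc) d)) (≈-sym (assoc _ _ _)))
  Drop-weight w (match {x = x} {y} {x′} {y′} d)
    rewrite rowWeight-∷ w false x | rowWeight-∷ w true y | rowWeight-∷ w false x′ | rowWeight-∷ w true y′ =
    ≈-trans (x∙yz≈y∙xz _ _ _) (≈-trans (∙-congˡ (Drop-weight (w ∘ suc) d)) (x∙yz≈y∙xz _ _ _))
  Drop-weight w (fall {x = x} {y} {x′} {y′} d)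
    rewrite rowWeight-∷ w false x | rowWeight-∷ w true y | rowWeight-∷ w true x′ | rowWeight-∷ w false y′ =
    ≈-trans (assoc _ _ _) (≈-trans (∙-congˡ (Drop-weight (w ∘ suc) d)) (x∙yz≈y∙xz _ _ _))

  rowsWeight : ∀ {n} → (Fin n → Carrier) → List (Subset n) → Carrier
  rowsWeight w = foldr (λ R acc → rowWeight w R ∙ acc) ε

  Insert-weight : ∀ {n} (w : Fin n → Carrier) {xs : List (Subset n)} {y N} → Insert xs y N →
                  rowsWeight w N ≈ rowsWeight w xs ∙ rowWeight w y
  Insert-weight w [ y ] = comm _ _
  Insert-weight w {x ∷ xs} {y} (_∷_ {z = z} {zs} {x′ = x′} {z′} d ins) = begin
    rowWeight w x′ ∙ (rowWeight w z′ ∙ rowsWeight w zs) ≈⟨ assoc _ _ _ ⟨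
    rowWeight w x′ ∙ rowWeight w z′ ∙ rowsWeight w zs   ≈⟨ ∙-congʳ (Drop-weight w d) ⟩
    rowWeight w x ∙ rowWeight w z ∙ rowsWeight w zs     ≈⟨ assoc _ _ _ ⟩
    rowWeight w x ∙ rowsWeight w (z ∷ zs)               ≈⟨ ∙-congˡ (Insert-weight w ins) ⟩
    rowWeight w x ∙ (rowsWeight w xs ∙ rowWeight w y)   ≈⟨ assoc _ _ _ ⟨
    rowsWeight w (x ∷ xs) ∙ rowWeight w y               ∎

  foldl-insertRow-weight : ∀ {n} (w : Fin n → Carrier) (acc rows : List (Subset n)) →
                           rowsWeight w (foldl insertRow acc rows) ≈ rowsWeight w acc ∙ rowsWeight w rows
  foldl-insertRow-weight w acc []         = ≈-sym (identityʳ _)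
  foldl-insertRow-weight w acc (y ∷ rows) =
    ≈-trans (foldl-insertRow-weight w (insertRow acc y) rows)
            (≈-trans (∙-congʳ (Insert-weight w (Insert-total acc y))) (assoc _ _ _))

  weight-ρN : ∀ {L n} (w : Fin n → Carrier) (B : BallSystem L n) → weight M w B ≈ weight M w (ρN B)
  weight-ρN w B = begin
    rowsWeight w (toList B)            ≈⟨ identityˡ _ ⟨
    ε ∙ rowsWeight w (toList B)        ≈⟨ foldl-insertRow-weight w [] (toList B) ⟨
    rowsWeight w (collapse (toList B)) ≡⟨ cong (rowsWeight w) (ρN-collapse B) ⟨
    rowsWeight w (toList (ρN B))       ∎

-- The Ferrari–Martin labelling

open CommutativeSemigroupProperties +-commutativeSemigroup using () renaming (x∙yz≈y∙xz to m+[n+o]≡n+[m+o])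

-- The indicator of `p ≤ c` as a number, so that counts are sums and terms can be cancelled.
ge : ℕ → ℕ → ℕ
ge zero    _       = 1
ge (suc _) zero    = 0
ge (suc p) (suc c) = ge p c

ge-≤ : ∀ {p c} → p ≤ c → ge p c ≡ 1
ge-≤ z≤n     = refl
ge-≤ (s≤s h) = ge-≤ h

ge-> : ∀ {p c} → c < p → ge p c ≡ 0
ge-> {suc p} {zero}  _       = refl
ge-> {suc p} {suc c} (s≤s h) = ge-> h

ge-mono : ∀ p {c d} → c ≤ d → ge p c ≤ ge p d
ge-mono zero    _           = ≤-refl
ge-mono (suc p) z≤n         = z≤n
ge-mono (suc p) (s≤s c≤d) = ge-mono p c≤d

ge-anti : ∀ {p q} c → p ≤ q → ge q c ≤ ge p c
ge-anti {p} {q} c p≤q with p ≤? c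
... | yes p≤c = ≤-trans (ge≤1 q c) (≤-reflexive (sym (ge-≤ p≤c)))
  where
  ge≤1 : ∀ q c → ge q c ≤ 1
  ge≤1 zero    _       = ≤-refl
  ge≤1 (suc q) zero    = z≤n
  ge≤1 (suc q) (suc c) = ge≤1 q c
... | no  p≰c = ≤-trans (≤-reflexive (ge-> (≤-trans (≰⇒> p≰c) p≤q))) z≤n

countGe : ℕ → List ℕ → ℕ
countGe p []       = 0
countGe p (c ∷ cs) = ge p c + countGe p cs

countGe-anti : ∀ {p q} cs → p ≤ q → countGe q cs ≤ countGe p cs
countGe-anti []       _   = z≤n
countGe-anti (c ∷ cs) p≤q = +-mono-≤ (ge-anti c p≤q) (countGe-anti cs p≤q)

countGe-zero : ∀ cs → countGe 0 cs ≡ length cs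
countGe-zero []       = refl
countGe-zero (c ∷ cs) = cong suc (countGe-zero cs)

countGe-++ : ∀ p cs ds → countGe p (cs ++ ds) ≡ countGe p cs + countGe p ds
countGe-++ p []       ds = refl
countGe-++ p (c ∷ cs) ds = trans (cong (ge p c +_) (countGe-++ p cs ds)) (sym (+-assoc (ge p c) _ _))

countGe-map-suc : ∀ p cs → countGe (suc p) (map suc cs) ≡ countGe p cs
countGe-map-suc p []       = refl
countGe-map-suc p (c ∷ cs) = cong (ge p c +_) (countGe-map-suc p cs)

cols-∷ : ∀ {n} b (R : Subset n) → cols (b ∷ R) ≡ (if b then 0 ∷ [] else []) ++ map suc (cols R)
cols-∷ true  R = trans (cong (map toℕ) (members-∷ true R))
                       (cong (0 ∷_) (trans (sym (map-∘ (members R))) (map-∘ (members R))))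
cols-∷ false R = trans (cong (map toℕ) (members-∷ false R))
                       (trans (sym (map-∘ (members R))) (map-∘ (members R)))

length-cols : ∀ {n} (R : Subset n) → length (cols R) ≡ ∣ R ∣
length-cols []          = refl
length-cols (true ∷ R)  = trans (cong length (cols-∷ true R)) (cong suc (trans (length-map suc (cols R)) (length-cols R)))
length-cols (false ∷ R) = trans (cong length (cols-∷ false R)) (trans (length-map suc (cols R)) (length-cols R))

countGe-cols-zero : ∀ {n} (R : Subset n) → countGe 0 (cols R) ≡ ∣ R ∣
countGe-cols-zero R = trans (countGe-zero (cols R)) (length-cols R)

countGe-cols-suc : ∀ {n} p b (R : Subset n) → countGe (suc p) (cols (b ∷ R)) ≡ countGe p (cols R)
countGe-cols-suc p true  R = trans (cong (countGe (suc p)) (cols-∷ true R)) (countGe-map-suc p (cols R))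
countGe-cols-suc p false R = trans (cong (countGe (suc p)) (cols-∷ false R)) (countGe-map-suc p (cols R))

AllPairs-cols : ∀ {n} (R : Subset n) → AllPairs _≤_ (cols R)
AllPairs-cols []      = []
AllPairs-cols (b ∷ R) = subst (AllPairs _≤_) (sym (cols-∷ b R)) (prepend b (map-suc (AllPairs-cols R)))
  where
  map-suc : ∀ {cs} → AllPairs _≤_ cs → AllPairs _≤_ (map suc cs)
  map-suc []       = []
  map-suc (p ∷ ps) = All.map⁺ (All.map s≤s p) ∷ map-suc ps
  prepend : ∀ b {cs} → AllPairs _≤_ cs → AllPairs _≤_ ((if b then 0 ∷ [] else []) ++ cs)
  prepend true  ps = All.universal (λ _ → z≤n) _ ∷ ps
  prepend false ps = ps

infix 4 _⊑_

-- `≼` for columns listed in any order, because pairing takes balls in the order of their labels and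
-- removes columns one by one.
_⊑_ : List ℕ → List ℕ → Set
cs ⊑ ds = ∀ p → countGe p cs ≤ countGe p ds

≼⇒⊑ : ∀ {n} {R S : Subset n} → R ≼ S → cols R ⊑ cols S
≼⇒⊑ []              p       = ≤-refl
≼⇒⊑ {R = R} {S} h@(_ ∷ _) zero =
  subst₂ _≤_ (sym (countGe-cols-zero R)) (sym (countGe-cols-zero S)) (≼-size h)
≼⇒⊑ {R = a ∷ R} {b ∷ S} (_ ∷ h) (suc p) =
  subst₂ _≤_ (sym (countGe-cols-suc p a R)) (sym (countGe-cols-suc p b S)) (≼⇒⊑ h p)

⊑⇒≼ : ∀ {n} (R S : Subset n) → cols R ⊑ cols S → R ≼ S
⊑⇒≼ []      []      h = []
⊑⇒≼ (a ∷ R) (b ∷ S) h =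
  subst₂ _≤_ (countGe-cols-zero (a ∷ R)) (countGe-cols-zero (b ∷ S)) (h 0) ∷
  ⊑⇒≼ R S λ p → subst₂ _≤_ (countGe-cols-suc p a R) (countGe-cols-suc p b S) (h (suc p))

data First (j : ℕ) : List ℕ → ℕ → Set where
  here  : ∀ {c cs} → j ≤ c → First j (c ∷ cs) c
  there : ∀ {c d cs} → d < j → First j cs c → First j (d ∷ cs) c

data Filtered (j : ℕ) (avail : List ℕ) : List ℕ → Set where
  none  : All (_< j) avail → Filtered j avail []
  first : ∀ {c cs} → First j avail c → Filtered j avail (c ∷ cs)

filtered : ∀ j avail → Filtered j avail (filter (λ c → j ≤? c) avail)
filtered j []          = none []
filtered j (d ∷ avail) with j ≤? d
... | yes j≤d rewrite filter-accept (λ c → j ≤? c) {xs = avail} j≤d = first (here j≤d)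
... | no  j≰d rewrite filter-reject (λ c → j ≤? c) {xs = avail} j≰d
  with filter (λ c → j ≤? c) avail | filtered j avail
...   | _ | none all = none (≰⇒> j≰d ∷ all)
...   | _ | first f  = first (there (≰⇒> j≰d) f)

data Choice (j : ℕ) : List ℕ → Maybe (ℕ × Bool) → Set where
  ahead : ∀ {avail c} → First j avail c → Choice j avail (just (c , false))
  wraps : ∀ {c cs} → All (_< j) (c ∷ cs) → Choice j (c ∷ cs) (just (c , true))
  none  : Choice j [] nothing

choice : ∀ j avail → Choice j avail (choose j avail)
choice j avail with filter (λ c → j ≤? c) avail | filtered j avail
... | c ∷ _ | first f = ahead f
... | [] | none all with avail
...   | c ∷ _ = wraps all
...   | []    = none

First-≤ : ∀ {j avail c} → First j avail c → j ≤ c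
First-≤ (here h)    = h
First-≤ (there _ f) = First-≤ f

-- No available column lies from `j` up to just before the chosen `c`.
First-none : ∀ {j avail c q} → AllPairs _≤_ avail → First j avail c → j ≤ q → q ≤ c → countGe q avail ≡ countGe j avail
First-none {j} {avail = c ∷ cs} {q = q} (c≤ ∷ _) (here j≤c) j≤q q≤c =
  cong₂ _+_ (trans (ge-≤ q≤c) (sym (ge-≤ j≤c))) (tail cs c≤)
  where
  tail : ∀ cs → All (c ≤_) cs → countGe q cs ≡ countGe j cs
  tail []       []         = refl
  tail (d ∷ cs) (c≤d ∷ ps) =
    cong₂ _+_ (trans (ge-≤ (≤-trans q≤c c≤d)) (sym (ge-≤ (≤-trans j≤c c≤d)))) (tail cs ps)
First-none (_ ∷ ps) (there d<j f) j≤q q≤c =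
  cong₂ _+_ (trans (ge-> (≤-trans d<j j≤q)) (sym (ge-> d<j))) (First-none ps f j≤q q≤c)

countGe-removeCol : ∀ {j avail c} p → First j avail c → countGe p avail ≡ ge p c + countGe p (removeCol c avail)
countGe-removeCol {avail = c ∷ _} p (here _) rewrite ≡ᵇ-refl c = refl
countGe-removeCol {j} {avail = d ∷ cs} {c} p (there d<j f)
  rewrite ≢⇒≡ᵇ-false {c} {d} (λ { refl → <⇒≱ d<j (First-≤ f) }) =
  trans (cong (ge p d +_) (countGe-removeCol p f))
    (m+[n+o]≡n+[m+o] (ge p d) (ge p c) (countGe p (removeCol c cs)))

removeCol-All : ∀ {P : ℕ → Set} c {avail} → All P avail → All P (removeCol c avail)
removeCol-All c []       = []
removeCol-All c (_∷_ {d} p ps) with c ≡ᵇ d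
... | true  = ps
... | false = p ∷ removeCol-All c ps

removeCol-AllPairs : ∀ c {avail} → AllPairs _≤_ avail → AllPairs _≤_ (removeCol c avail)
removeCol-AllPairs c []       = []
removeCol-AllPairs c (_∷_ {d} p ps) with c ≡ᵇ d
... | true  = ps
... | false = removeCol-All c p ∷ removeCol-AllPairs c ps

countGe-All< : ∀ {p cs} → All (_< p) cs → countGe p cs ≡ 0
countGe-All< []       = refl
countGe-All< (h ∷ hs) = cong₂ _+_ (ge-> h) (countGe-All< hs)

⊑-removeCol : ∀ {j js avail c} → AllPairs _≤_ avail → First j avail c → (j ∷ js) ⊑ avail → js ⊑ removeCol c avail
⊑-removeCol {j} {js} {avail} {c} sorted f h p = +-cancelˡ-≤ (ge p c) _ _ (subst (ge p c + countGe p js ≤_) (countGe-removeCol p f) goal)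
  where
  goal : ge p c + countGe p js ≤ countGe p avail
  goal with p ≤? j | p ≤? c
  ... | yes p≤j | _ = ≤-trans (≤-reflexive (cong (_+ _) (trans (ge-≤ (≤-trans p≤j (First-≤ f))) (sym (ge-≤ p≤j))))) (h p)
  ... | no _ | no p≰c = ≤-trans (≤-reflexive (cong (_+ countGe p js) (ge-> (≰⇒> p≰c)))) (≤-trans (m≤n+m _ (ge p j)) (h p))
  -- Only here does the lower row lose a counted column while the upper row loses none. Moving the
  -- threshold back to `j` adds no available column but does count the ball `j`, which pays for the
  -- loss.
  ... | no p≰j | yes p≤c = begin
    ge p c + countGe p js ≤⟨ +-mono-≤ (≤-reflexive (trans (ge-≤ p≤c) (sym (ge-≤ (≤-refl {j}))))) (countGe-anti js (<⇒≤ (≰⇒> p≰j))) ⟩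
    ge j j + countGe j js ≤⟨ h j ⟩
    countGe j avail       ≡⟨ First-none sorted f (<⇒≤ (≰⇒> p≰j)) p≤c ⟨
    countGe p avail       ∎
    where open ≤-Reasoning

-- Domination survives each pairing, whatever the order of the balls, and while it holds the next
-- ball finds a column weakly to its right.
pairAll-nowrap : ∀ r balls {avail} → AllPairs _≤_ avail → map proj₁ balls ⊑ avail → proj₂ (pairAll r balls avail) ≡ 0
pairAll-nowrap r [] _ _ = refl
pairAll-nowrap r ((j , ℓ) ∷ rest) {avail} sorted h with choose j avail | choice j avail
... | just (c , false) | ahead f =
  pairAll-nowrap r rest (removeCol-AllPairs c sorted) (⊑-removeCol {js = map proj₁ rest} sorted f h)
pairAll-nowrap r ((j , ℓ) ∷ rest) sorted h | _ | wraps all =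
  ⊥-elim (1+n≰n (≤-trans (≤-trans (≤-reflexive (sym (ge-≤ (≤-refl {j})))) (≤-trans (m≤m+n _ _) (h j))) (≤-reflexive (countGe-All< all))))
pairAll-nowrap r ((j , ℓ) ∷ rest) sorted h | _ | none with () ← h 0

-- A wrap costs `ℓ + 1 ∸ r`, which is positive as labels are at least `r`, and the length bound
-- excludes unpaired balls. So each ball goes to a column of its own weakly to the right.
pairAll-⊑ : ∀ r balls {avail} → All (λ q → r ≤ proj₂ q) balls → length balls ≤ length avail →
            proj₂ (pairAll r balls avail) ≡ 0 → map proj₁ balls ⊑ avail
pairAll-⊑ r [] _ _ _ p = z≤n
pairAll-⊑ r ((j , ℓ) ∷ rest) {avail} (r≤ℓ ∷ labels) h eq p with choose j avail | choice j avail
... | just (c , false) | ahead f =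
  ≤-trans (+-mono-≤ (ge-mono p (First-≤ f)) (pairAll-⊑ r rest labels shorter eq p))
          (≤-reflexive (sym (countGe-removeCol p f)))
  where
  shorter : length rest ≤ length (removeCol c avail)
  shorter = s≤s⁻¹ (≤-trans h (≤-reflexive
    (trans (sym (countGe-zero avail)) (trans (countGe-removeCol 0 f) (cong suc (countGe-zero (removeCol c avail)))))))
pairAll-⊑ r ((j , ℓ) ∷ rest) {c ∷ cs} (r≤ℓ ∷ labels) h eq p | just (.c , true) | wraps all =
  ⊥-elim (1+n≰n (≤-trans (≤-trans (≤-reflexive (+-comm 1 ℓ)) (m∸n≡0⇒m≤n (m+n≡0⇒m≡0 (ℓ + 1 ∸ r) eq))) r≤ℓ))
pairAll-⊑ r ((j , ℓ) ∷ rest) (r≤ℓ ∷ labels) () eq p | _ | none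

pairAll-labels : ∀ {P : ℕ → Set} r balls avail → All (λ q → P (proj₂ q)) balls →
                 All (λ q → P (proj₂ q)) (proj₁ (pairAll r balls avail))
pairAll-labels r [] avail [] = []
pairAll-labels r ((j , ℓ) ∷ rest) avail (h ∷ hs) with choose j avail
... | nothing = pairAll-labels r rest avail hs
... | just (c , _) = h ∷ pairAll-labels r rest (removeCol c avail) hs

labelOf-All : ∀ {P : ℕ → Set} c {ps dflt} → All (λ q → P (proj₂ q)) ps → P dflt → P (labelOf c ps dflt)
labelOf-All c []                   h = h
labelOf-All c (_∷_ {d , ℓ} p ps) h with c ≡ᵇ d
... | true  = p
... | false = labelOf-All c ps h

countGe-labelled : ∀ p K lab →
  countGe p (map proj₁ (filter (λ q → proj₂ q ≟ K) lab)) + countGe p (map proj₁ (filter (λ q → proj₂ q <? K) lab)) ≡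
  countGe p (map proj₁ (filter (λ q → proj₂ q <? suc K) lab))
countGe-labelled p K [] = refl
countGe-labelled p K (q ∷ lab) with ih ← countGe-labelled p K lab | <-cmp (proj₂ q) K
... | tri< ℓ<K ℓ≢K _
  rewrite dec-false (proj₂ q ≟ K) ℓ≢K | dec-true (proj₂ q <? K) ℓ<K
        | dec-true (proj₂ q <? suc K) (m<n⇒m<1+n ℓ<K) =
  trans (m+[n+o]≡n+[m+o] (countGe p (map proj₁ (filter (λ q → proj₂ q ≟ K) lab))) (ge p (proj₁ q)) _)
        (cong (ge p (proj₁ q) +_) ih)
... | tri≈ ℓ≮K ℓ≡K _
  rewrite dec-true (proj₂ q ≟ K) ℓ≡K | dec-false (proj₂ q <? K) ℓ≮K
        | dec-true (proj₂ q <? suc K) (s≤s (≤-reflexive ℓ≡K)) =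
  trans (+-assoc (ge p (proj₁ q)) _ _) (cong (ge p (proj₁ q) +_) ih)
... | tri> ℓ≮K ℓ≢K K<ℓ
  rewrite dec-false (proj₂ q ≟ K) ℓ≢K | dec-false (proj₂ q <? K) ℓ≮K
        | dec-false (proj₂ q <? suc K) (λ ℓ<1+K → <⇒≱ K<ℓ (s≤s⁻¹ ℓ<1+K)) = ih

countGe-orderBalls : ∀ p K lab →
  countGe p (map proj₁ (concatMap (λ ℓ → filter (λ q → proj₂ q ≟ ℓ) lab) (downFrom K))) ≡
  countGe p (map proj₁ (filter (λ q → proj₂ q <? K) lab))
countGe-orderBalls p zero    lab = sym (cong (countGe p ∘ map proj₁) (filter-none (λ q → proj₂ q <? 0) (All.universal (λ _ ()) lab)))
countGe-orderBalls p (suc K) lab =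
  trans (cong (countGe p) (map-++ proj₁ (filter (λ q → proj₂ q ≟ K) lab) _))
  (trans (countGe-++ p (map proj₁ (filter (λ q → proj₂ q ≟ K) lab)) _)
  (trans (cong (countGe p (map proj₁ (filter (λ q → proj₂ q ≟ K) lab)) +_) (countGe-orderBalls p K lab)) (countGe-labelled p K lab)))

-- Ordering by labels permutes the balls, and `⊑` sees counts only. A label above `m` would be lost,
-- because the label classes are listed from `m` downwards.
orderBalls-complete : ∀ {m lab} → All (λ q → proj₂ q ≤ m) lab → ∀ p →
                      countGe p (map proj₁ (orderBalls m lab)) ≡ countGe p (map proj₁ lab)
orderBalls-complete {m} {lab} labels p =
  trans (countGe-orderBalls p (suc m) lab)
        (cong (countGe p ∘ map proj₁) (filter-all (λ q → proj₂ q <? suc m) (All.map s≤s labels)))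

orderBalls-All : ∀ {P : ℕ × ℕ → Set} m {lab} → All P lab → All P (orderBalls m lab)
orderBalls-All m {lab} labels =
  All.concat⁺ (All.map⁺ (All.universal (λ ℓ → All.filter⁺ (λ q → proj₂ q ≟ ℓ) labels) (downFrom (suc m))))

-- The lower bound makes every wrap cost something; the upper bound keeps every ball in
-- `orderBalls`.
Labelled : ∀ {n} → ℕ → ℕ → List (ℕ × ℕ) → Subset n → Set
Labelled m r lab R = map proj₁ lab ≡ cols R × All (λ q → r ≤ proj₂ q × proj₂ q ≤ m) lab

map-proj₁ : ∀ (f : ℕ → ℕ) cs → map proj₁ (map (λ c → c , f c) cs) ≡ cs
map-proj₁ f cs = trans (sym (map-∘ cs)) (map-id cs)

-- Inherited labels are at least `r`, and the default `r ∸ 1` of the unpaired balls is the new lower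
-- bound.
Labelled-next : ∀ {n m r ps} (R : Subset n) → r ≤ m → All (λ q → r ≤ proj₂ q × proj₂ q ≤ m) ps →
                Labelled m (r ∸ 1) (map (λ c → c , labelOf c ps (r ∸ 1)) (cols R)) R
Labelled-next {m = m} {r} R r≤m labels =
  map-proj₁ _ (cols R) ,
  All.map⁺ (All.universal (λ c → labelOf-All {λ ℓ → r ∸ 1 ≤ ℓ × ℓ ≤ m} c
    (All.map (λ (r≤ℓ , ℓ≤m) → ≤-trans (m∸n≤m r 1) r≤ℓ , ℓ≤m) labels) (≤-refl , ≤-trans (m∸n≤m r 1) r≤m)) (cols R))

module _ {n m r lab} {R : Subset n} (labelled : Labelled m r lab R) where

  orderBalls-count : ∀ p → countGe p (map proj₁ (orderBalls m lab)) ≡ countGe p (cols R)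
  orderBalls-count p = trans (orderBalls-complete (All.map proj₂ (proj₂ labelled)) p)
                             (cong (countGe p) (proj₁ labelled))

  paired-labels : ∀ avail → All (λ q → r ≤ proj₂ q × proj₂ q ≤ m) (proj₁ (pairAll r (orderBalls m lab) avail))
  paired-labels avail = pairAll-labels {λ ℓ → r ≤ ℓ × ℓ ≤ m} r (orderBalls m lab) avail (orderBalls-All m (proj₂ labelled))

  pairing-nowrap : ∀ {S : Subset n} → R ≼ S → proj₂ (pairAll r (orderBalls m lab) (cols S)) ≡ 0
  pairing-nowrap {S} R≼S = pairAll-nowrap r (orderBalls m lab) (AllPairs-cols S)
    λ p → ≤-trans (≤-reflexive (orderBalls-count p)) (≼⇒⊑ R≼S p)

  nowrap-≼ : ∀ {S : Subset n} → ∣ R ∣ ≤ ∣ S ∣ → proj₂ (pairAll r (orderBalls m lab) (cols S)) ≡ 0 → R ≼ S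
  nowrap-≼ {S} |R|≤|S| eq = ⊑⇒≼ R S λ p → ≤-trans (≤-reflexive (sym (orderBalls-count p)))
    (pairAll-⊑ r (orderBalls m lab) (All.map proj₁ (orderBalls-All m (proj₂ labelled))) short eq p)
    where
    short : length (orderBalls m lab) ≤ length (cols S)
    short = begin
      length (orderBalls m lab)                  ≡⟨ length-map proj₁ (orderBalls m lab) ⟨
      length (map proj₁ (orderBalls m lab))      ≡⟨ countGe-zero (map proj₁ (orderBalls m lab)) ⟨
      countGe 0 (map proj₁ (orderBalls m lab))   ≡⟨ orderBalls-count 0 ⟩
      countGe 0 (cols R)                         ≡⟨ countGe-cols-zero R ⟩
      ∣ R ∣                                      ≤⟨ |R|≤|S| ⟩
      ∣ S ∣                                      ≡⟨ length-cols S ⟨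
      length (cols S)                            ∎
      where open ≤-Reasoning

fmGo-zero : ∀ {n} m r lab (R : Subset n) rest → r ≤ m → Labelled m r lab R → Linked _≼_ (R ∷ rest) →
            fmGo m r lab rest ≡ 0
fmGo-zero m r lab R []       _   _        _         = refl
fmGo-zero m r lab R (S ∷ rest) r≤m labelled (R≼S ∷ l) =
  cong₂ _+_ (pairing-nowrap labelled R≼S)
    (fmGo-zero m (r ∸ 1) _ S rest (≤-trans (m∸n≤m r 1) r≤m)
      (Labelled-next S r≤m (paired-labels labelled (cols S))) l)

fmGo-≼ : ∀ {n} m r lab (R : Subset n) rest → r ≤ m → Labelled m r lab R → Linked (λ R S → ∣ R ∣ ≤ ∣ S ∣) (R ∷ rest) →
         fmGo m r lab rest ≡ 0 → Linked _≼_ (R ∷ rest)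
fmGo-≼ m r lab R []         _   _        _       _  = [-]
fmGo-≼ m r lab R (S ∷ rest) r≤m labelled (h ∷ l) eq =
  nowrap-≼ labelled h (m+n≡0⇒m≡0 (proj₂ (pairAll r (orderBalls m lab) (cols S))) eq) ∷
  fmGo-≼ m (r ∸ 1) _ S rest (≤-trans (m∸n≤m r 1) r≤m)
    (Labelled-next S r≤m (paired-labels labelled (cols S))) l
    (m+n≡0⇒n≡0 (proj₂ (pairAll r (orderBalls m lab) (cols S))) eq)

Linked-reverse : ∀ {A : Set} {R : A → A → Set} {xs} → Linked R xs → Linked (flip R) (reverse xs)
Linked-reverse {xs = []}     _ = []
Linked-reverse {A} {R} {xs = x ∷ xs} l = onto x xs [] l [-]
  where
  onto : ∀ x xs ys → Linked R (x ∷ xs) → Linked (flip R) (x ∷ ys) → Linked (flip R) (xs ʳ++ (x ∷ ys))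
  onto x []       ys _       acc = acc
  onto x (y ∷ xs) ys (r ∷ l) acc = onto y xs (x ∷ ys) l (r ∷ acc)

Linked-unreverse : ∀ {A : Set} {R : A → A → Set} xs → Linked R (reverse xs) → Linked (flip R) xs
Linked-unreverse xs l = subst (Linked _) (reverse-involutive xs) (Linked-reverse l)

Labelled-top : ∀ {n} m (R : Subset n) → Labelled m m (map (λ c → c , m) (cols R)) R
Labelled-top m R =
  map-proj₁ _ (cols R) , All.map⁺ (All.universal (λ _ → ≤-refl , ≤-refl) (cols R))

Nested⇒maj≡0 : ∀ {n} (M : List (Subset n)) → Nested M → maj M ≡ 0
Nested⇒maj≡0 M N with reverse M | Linked-reverse N
... | []       | _ = refl
... | R ∷ rest | l = fmGo-zero (length M) (length M) _ R rest ≤-refl (Labelled-top (length M) R) l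

maj≡0⇒Nested : ∀ {n} (M : List (Subset n)) → Linked (λ R S → ∣ S ∣ ≤ ∣ R ∣) M → maj M ≡ 0 → Nested M
maj≡0⇒Nested M dec eq = Linked-unreverse M (go eq)
  where
  go : maj M ≡ 0 → Linked _≼_ (reverse M)
  go eq with reverse M | Linked-reverse dec
  ... | []       | _ = []
  ... | R ∷ rest | l = fmGo-≼ (length M) (length M) _ R rest ≤-refl (Labelled-top (length M) R) l eq

-- Conjugate partitions

part≥ : ℕ → List ℕ → ℕ
part≥ r μ = length (filter (λ a → r ≤? a) μ)

part≥-anti : ∀ r μ → part≥ (suc r) μ ≤ part≥ r μ
part≥-anti r []      = z≤n
part≥-anti r (a ∷ μ) with r <? a | r ≤? a
... | yes r<a | yes r≤a rewrite dec-true (r <? a) r<a | dec-true (r ≤? a) r≤a = s≤s (part≥-anti r μ)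
... | yes r<a | no r≰a with () ← r≰a (<⇒≤ r<a)
... | no r≮a | yes r≤a rewrite dec-false (r <? a) r≮a | dec-true (r ≤? a) r≤a = m≤n⇒m≤1+n (part≥-anti r μ)
... | no r≮a | no r≰a rewrite dec-false (r <? a) r≮a | dec-false (r ≤? a) r≰a = part≥-anti r μ

part≥-positive : ∀ r μ → r < foldr _⊔_ 0 μ → 1 ≤ part≥ (suc r) μ
part≥-positive r (a ∷ μ) r<max with r <? a
... | yes r<a rewrite dec-true (r <? a) r<a = s≤s z≤n
... | no r≮a rewrite dec-false (r <? a) r≮a =
  part≥-positive r μ (subst (r <_) (m≤n⇒m⊔n≡n (≮⇒≥ λ max<a → r≮a (subst (r <_) (m≥n⇒m⊔n≡m (<⇒≤ max<a)) r<max))) r<max)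

conj-partition : ∀ μ → IsPartition (conj μ)
conj-partition μ =
  Linked.map⁺ (Linked.map⁺ (Linked.applyUpTo⁺₂ id _ λ r → part≥-anti (suc r) μ)) ,
  All.map⁺ (All.map⁺ (All.applyUpTo⁺₁ id _ λ {r} → part≥-positive r μ))

-- The Young diagram with a new leftmost column of height `a`, missing parts counting as 0. Parts of
-- `μ` beyond the first `a` would be cut off, hence the length bounds below.
addColumn : ℕ → List ℕ → List ℕ
addColumn zero    _       = []
addColumn (suc a) []      = 1 ∷ addColumn a []
addColumn (suc a) (b ∷ μ) = suc b ∷ addColumn a μ

part≥-addColumn-1 : ∀ a μ → part≥ 1 (addColumn a μ) ≡ a
part≥-addColumn-1 zero    μ       = refl
part≥-addColumn-1 (suc a) []      = cong suc (part≥-addColumn-1 a [])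
part≥-addColumn-1 (suc a) (b ∷ μ) = cong suc (part≥-addColumn-1 a μ)

part≥-addColumn : ∀ r a μ → length μ ≤ a → part≥ (suc (suc r)) (addColumn a μ) ≡ part≥ (suc r) μ
part≥-addColumn r zero    []      _       = refl
part≥-addColumn r (suc a) []      _       = part≥-addColumn r a [] z≤n
part≥-addColumn r (suc a) (b ∷ μ) (s≤s h) with r <ᵇ b
... | true  = cong suc (part≥-addColumn r a μ h)
... | false = part≥-addColumn r a μ h

max-addColumn : ∀ a μ → length μ ≤ suc a → foldr _⊔_ 0 (addColumn (suc a) μ) ≡ suc (foldr _⊔_ 0 μ)
max-addColumn zero    []          _       = refl
max-addColumn zero    (b ∷ [])    _       = cong suc (sym (⊔-identityʳ b))
max-addColumn zero    (b ∷ _ ∷ _) (s≤s ())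
max-addColumn (suc a) []          _       = cong (1 ⊔_) (max-addColumn a [] z≤n)
max-addColumn (suc a) (b ∷ μ)     (s≤s h) = cong (suc b ⊔_) (max-addColumn a μ h)

addColumn-partition : ∀ a {μ} → IsPartition μ → IsPartition (addColumn a μ)
addColumn-partition a {μ} (dec , _) = decreasing a μ dec , positive a μ
  where
  decreasing : ∀ a μ → Linked _≥_ μ → Linked _≥_ (addColumn a μ)
  decreasing zero          μ           _       = []
  decreasing (suc zero)    []          _       = [-]
  decreasing (suc (suc a)) []          _       = ≤-refl ∷ decreasing (suc a) [] []
  decreasing (suc zero)    (b ∷ μ)     _       = [-]
  decreasing (suc (suc a)) (b ∷ [])    _       = s≤s z≤n ∷ decreasing (suc a) [] []
  decreasing (suc (suc a)) (b ∷ d ∷ μ) (h ∷ l) = s≤s h ∷ decreasing (suc a) (d ∷ μ) l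
  positive : ∀ a μ → All (λ b → 1 ≤ b) (addColumn a μ)
  positive zero    μ       = []
  positive (suc a) []      = s≤s z≤n ∷ positive a []
  positive (suc a) (b ∷ μ) = s≤s z≤n ∷ positive a μ

length-addColumn : ∀ a μ → length (addColumn a μ) ≡ a
length-addColumn zero    μ       = refl
length-addColumn (suc a) []      = cong suc (length-addColumn a [])
length-addColumn (suc a) (b ∷ μ) = cong suc (length-addColumn a μ)

-- The new column becomes the first row of the transpose, and every old row of it moves up by one.
conj-addColumn : ∀ a μ → length μ ≤ suc a → conj (addColumn (suc a) μ) ≡ suc a ∷ conj μ
conj-addColumn a μ h rewrite max-addColumn a μ h =
  cong₂ _∷_ (part≥-addColumn-1 (suc a) μ) (begin
    map F (map suc (applyUpTo suc m))  ≡⟨ cong (map F ∘ map suc) (map-upTo suc m) ⟨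
    map F (map suc (map suc (upTo m))) ≡⟨ map-∘ (map suc (upTo m)) ⟨
    map (F ∘ suc) (map suc (upTo m))   ≡⟨ map-∘ (upTo m) ⟨
    map (λ r → F (suc (suc r))) (upTo m) ≡⟨ map-cong (λ r → part≥-addColumn r (suc a) μ h) (upTo m) ⟩
    map ((λ r → part≥ r μ) ∘ suc) (upTo m)     ≡⟨ map-∘ (upTo m) ⟩
    conj μ ∎)
  where
  open ≡-Reasoning
  m = foldr _⊔_ 0 μ
  F = λ r → part≥ r (addColumn (suc a) μ)

-- Shapes in the target are conjugates, so the row sizes obtained have to be presented as one. The
-- last component is what the next `addColumn` requires: a part that may precede `ν` is tall enough
-- for all of `μ`. Put this way, it covers the empty `ν` too.
conj-surjective : ∀ ν → IsPartition ν →
                  ∃ λ μ → IsPartition μ × conj μ ≡ ν × (∀ a → Linked _≥_ (a ∷ ν) → length μ ≤ a)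
conj-surjective [] _ = [] , ([] , []) , refl , λ _ _ → z≤n
conj-surjective (suc a ∷ ν) (dec , _ ∷ pos) with μ , P , eq , short ← conj-surjective ν (Linked.tail dec , pos) =
  addColumn (suc a) μ , addColumn-partition (suc a) P ,
  trans (conj-addColumn a μ (short (suc a) dec)) (cong (suc a ∷_) eq) ,
  λ { b (h ∷ _) → ≤-trans (≤-reflexive (length-addColumn (suc a) μ)) h }

-- Trimming empty rows at the top

Linked-++⁻ˡ : ∀ {A : Set} {R : A → A → Set} xs {ys} → Linked R (xs ++ ys) → Linked R xs
Linked-++⁻ˡ []           _       = []
Linked-++⁻ˡ (x ∷ [])     _       = [-]
Linked-++⁻ˡ (x ∷ y ∷ xs) (r ∷ l) = r ∷ Linked-++⁻ˡ (y ∷ xs) l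

module _ {A : Set} (p : A → Bool) where

  stripTop-prefix : ∀ xs → ∃ λ ys → xs ≡ stripTop p xs ++ ys × All (λ x → p x ≡ true) ys
  stripTop-prefix [] = [] , refl , []
  stripTop-prefix (x ∷ xs) with stripTop p xs | stripTop-prefix xs
  ... | z ∷ zs | ys , eq , all = ys , cong (x ∷_) eq , all
  ... | []     | ys , eq , all with p x in px
  ...   | true  = x ∷ ys , cong (x ∷_) eq , px ∷ all
  ...   | false = ys , cong (x ∷_) eq , all

  stripTop-++ : ∀ xs ys → All (λ x → p x ≡ false) xs → All (λ x → p x ≡ true) ys → stripTop p (xs ++ ys) ≡ xs
  stripTop-++ []       []       _        _        = refl
  stripTop-++ []       (y ∷ ys) _        (py ∷ q) rewrite stripTop-++ [] ys [] q | py = refl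
  stripTop-++ (x ∷ xs) ys       (px ∷ ps) q rewrite stripTop-++ xs ys ps q | px with xs
  ... | []    = refl
  ... | _ ∷ _ = refl

  -- Equal lengths restore what trimming forgets, as the removed tails consist of copies of `e`.
  stripTop-injective : ∀ e → (∀ x → p x ≡ true → x ≡ e) → ∀ xs ys → length xs ≡ length ys →
                       stripTop p xs ≡ stripTop p ys → xs ≡ ys
  stripTop-injective e unique xs ys |xs|≡|ys| eq
    with us , eqx , pus ← stripTop-prefix xs | vs , eqy , pvs ← stripTop-prefix ys =
    trans eqx (trans (cong₂ _++_ eq (same us vs pus pvs |us|≡|vs|)) (sym eqy))
    where
    |us|≡|vs| : length us ≡ length vs
    |us|≡|vs| = +-cancelˡ-≡ (length (stripTop p xs)) _ _
      (trans (sym (trans (cong length eqx) (length-++ (stripTop p xs))))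
        (trans |xs|≡|ys| (trans (trans (cong length eqy) (length-++ (stripTop p ys))) (cong (λ z → length z + length vs) (sym eq)))))
    same : ∀ us vs → All (λ x → p x ≡ true) us → All (λ x → p x ≡ true) vs → length us ≡ length vs → us ≡ vs
    same []       []       _        _        _  = refl
    same (u ∷ us) (v ∷ vs) (pu ∷ a) (pv ∷ b) eq =
      cong₂ _∷_ (trans (unique u pu) (sym (unique v pv))) (same us vs a b (suc-injective eq))

  stripTop-map : ∀ {B : Set} (q : B → Bool) (f : A → B) → (∀ x → p x ≡ q (f x)) →
                 ∀ xs → map f (stripTop p xs) ≡ stripTop q (map f xs)
  stripTop-map q f p≗q∘f [] = refl
  stripTop-map q f p≗q∘f (x ∷ xs) rewrite sym (stripTop-map q f p≗q∘f xs) | p≗q∘f x with stripTop p xs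
  ... | _ ∷ _ = refl
  ... | [] with q (f x)
  ...   | true  = refl
  ...   | false = refl

  stripTop-All : ∀ {P : A → Set} {xs} → All P xs → All P (stripTop p xs)
  stripTop-All {P} {xs} all with ys , eq , _ ← stripTop-prefix xs = All.++⁻ˡ (stripTop p xs) (subst (All P) eq all)

  stripTop-Linked : ∀ {R : A → A → Set} {xs} → Linked R xs → Linked R (stripTop p xs)
  stripTop-Linked {R} {xs} l with ys , eq , _ ← stripTop-prefix xs = Linked-++⁻ˡ (stripTop p xs) (subst (Linked R) eq l)

-- In a weakly decreasing sequence a zero is followed by zeros only, so trimming removes them all.
stripTop-partition : ∀ {ν} → Linked _≥_ ν → IsPartition (stripTop (λ a → a ≡ᵇ 0) ν)
stripTop-partition dec = stripTop-Linked _ dec , positive dec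
  where
  zeros : ∀ {ν} → Linked _≥_ (0 ∷ ν) → stripTop (λ a → a ≡ᵇ 0) (0 ∷ ν) ≡ []
  zeros {[]}    _ = refl
  zeros {0 ∷ ν} (_ ∷ l) rewrite zeros l = refl
  positive : ∀ {ν} → Linked _≥_ ν → All (λ a → 1 ≤ a) (stripTop (λ a → a ≡ᵇ 0) ν)
  positive {[]} _ = []
  positive {zero ∷ ν}  l = subst (All _) (sym (zeros l)) []
  positive {suc a ∷ ν} l with stripTop (λ a → a ≡ᵇ 0) ν | positive (Linked.tail l)
  ... | []    | _  = s≤s z≤n ∷ []
  ... | _ ∷ _ | ps = s≤s z≤n ∷ ps

-- Semistandard tableaux

-- With its arguments swapped, `ge x k` is the indicator of `x ≤ k`.
countLe : ℕ → List ℕ → ℕ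
countLe k []       = 0
countLe k (x ∷ xs) = ge x k + countLe k xs

countLe-++ : ∀ k xs ys → countLe k (xs ++ ys) ≡ countLe k xs + countLe k ys
countLe-++ k []       ys = refl
countLe-++ k (x ∷ xs) ys = trans (cong (ge x k +_) (countLe-++ k xs ys)) (sym (+-assoc (ge x k) _ _))

countLe-mono : ∀ xs {k l} → k ≤ l → countLe k xs ≤ countLe l xs
countLe-mono []       _   = z≤n
countLe-mono (x ∷ xs) k≤l = +-mono-≤ (ge-mono x k≤l) (countLe-mono xs k≤l)

countLe-All> : ∀ {k xs} → All (k <_) xs → countLe k xs ≡ 0
countLe-All> []       = refl
countLe-All> (h ∷ hs) = cong₂ _+_ (ge-> h) (countLe-All> hs)

countLe-All≤ : ∀ {k xs} → All (_≤ k) xs → countLe k xs ≡ length xs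
countLe-All≤ []       = refl
countLe-All≤ (h ∷ hs) = cong₂ _+_ (ge-≤ h) (countLe-All≤ hs)

countLe-⊓ : ∀ {L xs} k → All (_≤ L) xs → countLe (k ⊓ L) xs ≡ countLe k xs
countLe-⊓ {L} k all with ≤-total k L
... | inj₁ k≤L rewrite m≤n⇒m⊓n≡m k≤L = refl
... | inj₂ L≤k rewrite m≥n⇒m⊓n≡n L≤k =
  trans (countLe-All≤ all) (sym (countLe-All≤ (All.map (λ x≤L → ≤-trans x≤L L≤k) all)))

countLe-head : ∀ x xs → 1 ≤ countLe x (x ∷ xs)
countLe-head x xs = ≤-trans (≤-reflexive (sym (ge-≤ (≤-refl {x})))) (m≤m+n _ _)

below-sorted : ∀ {k x xs} → AllPairs _≤_ (x ∷ xs) → k < x → countLe k (x ∷ xs) ≡ 0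
below-sorted (x≤ ∷ _) k<x = countLe-All> (k<x ∷ All.map (<-≤-trans k<x) x≤)

-- The smaller of two different heads would be counted in one of the lists only.
sorted-unique : ∀ {xs ys} → AllPairs _≤_ xs → AllPairs _≤_ ys → (∀ k → countLe k xs ≡ countLe k ys) → xs ≡ ys
sorted-unique {[]}     {[]}     _ _ _ = refl
sorted-unique {[]}     {y ∷ ys} _ _ h = ⊥-elim (1+n≰n (≤-trans (countLe-head y ys) (≤-reflexive (sym (h y)))))
sorted-unique {x ∷ xs} {[]}     _ _ h = ⊥-elim (1+n≰n (≤-trans (countLe-head x xs) (≤-reflexive (h x))))
sorted-unique {x ∷ xs} {y ∷ ys} S@(_ ∷ S′) U@(_ ∷ U′) h with <-cmp x y
... | tri< x<y _ _ = ⊥-elim (1+n≰n (≤-trans (countLe-head x xs) (≤-reflexive (trans (h x) (below-sorted U x<y)))))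
... | tri> _ _ y<x = ⊥-elim (1+n≰n (≤-trans (countLe-head y ys) (≤-reflexive (trans (sym (h y)) (below-sorted S y<x)))))
... | tri≈ _ refl _ = cong (x ∷_) (sorted-unique S′ U′ λ k → +-cancelˡ-≡ (ge x k) _ _ (h k))

-- At `k = y` the head `suc y` is counted, so some entry of `xs`, hence its least one, is at most
-- `y`. For the tails, either both heads count and cancel or nothing in `ys` counts.
counts⇒StrictlyBelow : ∀ {xs ys} → AllPairs _≤_ xs → AllPairs _≤_ ys → All (1 ≤_) ys →
                       (∀ k → countLe (suc k) ys ≤ countLe k xs) → StrictlyBelow xs ys
counts⇒StrictlyBelow {[]}     {_}      _ _ _ _ = []
counts⇒StrictlyBelow {x ∷ xs} {[]}     _ _ _ _ = []
counts⇒StrictlyBelow {x ∷ xs} {suc y ∷ ys} S@(_ ∷ S′) U@(_ ∷ U′) (_ ∷ pos) h = x<y ∷ counts⇒StrictlyBelow S′ U′ pos rest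
  where
  x<y : x < suc y
  x<y with x ≤? y
  ... | yes x≤y = s≤s x≤y
  ... | no x≰y = ⊥-elim (1+n≰n (≤-trans (countLe-head (suc y) ys) (≤-trans (h y) (≤-reflexive (below-sorted S (≰⇒> x≰y))))))
  rest : ∀ k → countLe (suc k) ys ≤ countLe k xs
  rest k with y ≤? k
  ... | yes y≤k = s≤s⁻¹ (subst₂ (λ a b → a + countLe (suc k) ys ≤ b + countLe k xs)
                           (ge-≤ y≤k) (ge-≤ (≤-trans (s≤s⁻¹ x<y) y≤k)) (h k))
  ... | no y≰k = ≤-trans (m≤n+m _ (ge (suc y) (suc k)))
                   (≤-trans (≤-reflexive (below-sorted U (s≤s (≰⇒> y≰k)))) z≤n)

-- `StrictlyBelow` reaches only as far as the shorter list; the length bound gives every entry of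
-- `ys` a smaller one below it.
StrictlyBelow⇒counts : ∀ {xs ys} → length ys ≤ length xs → StrictlyBelow xs ys → ∀ k → countLe (suc k) ys ≤ countLe k xs
StrictlyBelow⇒counts {_}      {[]}     _         _          k = z≤n
StrictlyBelow⇒counts {x ∷ xs} {suc y ∷ ys} (s≤s h) (s≤s x≤y ∷ p) k =
  +-mono-≤ (ge-anti k x≤y) (StrictlyBelow⇒counts h p k)

-- For `f` weakly increasing from 0, the sorted row with `f k` entries at most `k`.
fill : ℕ → (ℕ → ℕ) → List ℕ
fill zero    f = []
fill (suc L) f = fill L f ++ replicate (f (suc L) ∸ f L) (suc L)

fill-concatMap : ∀ L f → concatMap (λ k → replicate (f k ∸ f (k ∸ 1)) k) (map suc (upTo L)) ≡ fill L f
fill-concatMap zero    f = refl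
fill-concatMap (suc L) f = begin
  concatMap g (map suc (upTo (suc L)))     ≡⟨ cong (concatMap g ∘ map suc) (upTo-∷ʳ L) ⟨
  concatMap g (map suc (upTo L ∷ʳ L))      ≡⟨ cong (concatMap g) (map-++ suc (upTo L) (L ∷ [])) ⟩
  concatMap g (map suc (upTo L) ∷ʳ suc L)  ≡⟨ concatMap-++ g (map suc (upTo L)) (suc L ∷ []) ⟩
  concatMap g (map suc (upTo L)) ++ (g (suc L) ++ [])
    ≡⟨ cong₂ _++_ (fill-concatMap L f) (++-identityʳ (g (suc L))) ⟩
  fill (suc L) f ∎
  where
  open ≡-Reasoning
  g = λ k → replicate (f k ∸ f (k ∸ 1)) k

fill-cong : ∀ L {f g} → (∀ k → k ≤ L → f k ≡ g k) → fill L f ≡ fill L g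
fill-cong zero    _ = refl
fill-cong (suc L) h = cong₂ _++_ (fill-cong L λ k k≤L → h k (m≤n⇒m≤1+n k≤L))
  (cong₂ (λ a b → replicate (a ∸ b) (suc L)) (h (suc L) ≤-refl) (h L (n≤1+n L)))

fill-bounds : ∀ L f → All (λ a → 1 ≤ a × a ≤ L) (fill L f)
fill-bounds zero    f = []
fill-bounds (suc L) f = All.++⁺ (All.map (λ (p , q) → p , m≤n⇒m≤1+n q) (fill-bounds L f))
                                (All.replicate⁺ (f (suc L) ∸ f L) (s≤s z≤n , ≤-refl))

fill-sorted : ∀ L f → AllPairs _≤_ (fill L f)
fill-sorted zero    f = []
fill-sorted (suc L) f = AllPairs.++⁺ (fill-sorted L f) (constant (f (suc L) ∸ f L))
  (All.map (λ (_ , a≤L) → All.replicate⁺ (f (suc L) ∸ f L) (m≤n⇒m≤1+n a≤L)) (fill-bounds L f))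
  where
  constant : ∀ m → AllPairs _≤_ (replicate m (suc L))
  constant zero    = []
  constant (suc m) = All.replicate⁺ m ≤-refl ∷ constant m

module _ {f : ℕ → ℕ} (f0 : f 0 ≡ 0) where

  length-fill : ∀ L → (∀ k → k < L → f k ≤ f (suc k)) → length (fill L f) ≡ f L
  length-fill zero    mono = sym f0
  length-fill (suc L) mono = trans (length-++ (fill L f))
    (trans (cong₂ _+_ (length-fill L λ k k<L → mono k (m<n⇒m<1+n k<L)) (length-replicate (f (suc L) ∸ f L)))
           (m+[n∸m]≡n (mono L ≤-refl)))

  countLe-fill : ∀ L → (∀ k → k < L → f k ≤ f (suc k)) → ∀ k → countLe k (fill L f) ≡ f (k ⊓ L)
  countLe-fill L mono k with L ≤? k
  ... | yes L≤k rewrite m≥n⇒m⊓n≡n L≤k =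
    trans (countLe-All≤ (All.map (λ (_ , a≤L) → ≤-trans a≤L L≤k) (fill-bounds L f))) (length-fill L mono)
  countLe-fill zero    mono k | no L≰k = ⊥-elim (L≰k z≤n)
  countLe-fill (suc L) mono k | no L≰k with s≤s k≤L ← ≰⇒> L≰k rewrite m≤n⇒m⊓n≡m (m≤n⇒m≤1+n k≤L) = begin
    countLe k (fill (suc L) f)  ≡⟨ countLe-++ k (fill L f) _ ⟩
    countLe k (fill L f) + countLe k (replicate (f (suc L) ∸ f L) (suc L))
      ≡⟨ cong₂ _+_ (countLe-fill L (λ k k<L → mono k (m<n⇒m<1+n k<L)) k)
                   (countLe-All> (All.replicate⁺ (f (suc L) ∸ f L) (s≤s k≤L))) ⟩
    f (k ⊓ L) + 0               ≡⟨ +-identityʳ _ ⟩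
    f (k ⊓ L)                   ≡⟨ cong f (m≤n⇒m⊓n≡m k≤L) ⟩
    f k                         ∎
    where open ≡-Reasoning

-- A semistandard tableau with entries at most L as a chain of shapes: c k i is the number of entries
-- at most k in row i.
record Chain (L : ℕ) (c : ℕ → ℕ → ℕ) : Set where
  field
    start  : ∀ i → c 0 i ≡ 0
    grow   : ∀ k i → k < L → c k i ≤ c (suc k) i
    strict : ∀ k i → k < L → c (suc k) (suc i) ≤ c k i

  -- `strict` lowers stage and row together, so a row at least as high as its stage is bounded by
  -- the empty stage 0.
  vanish : ∀ k i → k ≤ L → k ≤ i → c k i ≡ 0
  vanish zero    i       _   _         = start i
  vanish (suc k) (suc i) k<L (s≤s k≤i) =
    n≤0⇒n≡0 (≤-trans (strict k i k<L) (≤-reflexive (vanish k i (<⇒≤ k<L) k≤i)))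

  decreasing : ∀ i → c L (suc i) ≤ c L i
  decreasing = go L ≤-refl
    where
    go : ∀ k → k ≤ L → ∀ i → c k (suc i) ≤ c k i
    go zero    _   i = ≤-reflexive (trans (start (suc i)) (sym (start i)))
    go (suc k) k<L i = ≤-trans (strict k i k<L) (grow k i k<L)

  rowOf : ℕ → List ℕ
  rowOf i = fill L (λ k → c k i)

  length-rowOf : ∀ i → length (rowOf i) ≡ c L i
  length-rowOf i = length-fill (start i) L (λ k → grow k i)

  countLe-rowOf : ∀ k i → countLe k (rowOf i) ≡ c (k ⊓ L) i
  countLe-rowOf k i = countLe-fill (start i) L (λ k → grow k i) k

  rowOf-strict : ∀ i → StrictlyBelow (rowOf i) (rowOf (suc i))
  rowOf-strict i = counts⇒StrictlyBelow (fill-sorted L _) (fill-sorted L _) (All.map proj₁ (fill-bounds L _)) counts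
    where
    counts : ∀ k → countLe (suc k) (rowOf (suc i)) ≤ countLe k (rowOf i)
    counts k = subst₂ _≤_ (sym (countLe-rowOf (suc k) (suc i))) (sym (countLe-rowOf k i)) goal
      where
      goal : c (suc k ⊓ L) (suc i) ≤ c (k ⊓ L) i
      goal with k <? L
      ... | yes k<L rewrite m≤n⇒m⊓n≡m k<L | m≤n⇒m⊓n≡m (<⇒≤ k<L) = strict k i k<L
      -- Past the largest entry both stages are `L`, and strictness is replaced by the decrease of
      -- the row lengths.
      ... | no k≮L rewrite m≥n⇒m⊓n≡n (≮⇒≥ k≮L) | m≥n⇒m⊓n≡n (m≤n⇒m≤1+n (≮⇒≥ k≮L)) = decreasing i

  tableau : Tableau
  tableau = stripTop null (applyUpTo rowOf L)

  tableau-shape : map length tableau ≡ stripTop (λ a → a ≡ᵇ 0) (applyUpTo (c L) L)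
  tableau-shape = trans (stripTop-map null (λ a → a ≡ᵇ 0) length (λ { [] → refl ; (_ ∷ _) → refl }) (applyUpTo rowOf L))
    (cong (stripTop (λ a → a ≡ᵇ 0)) (trans (map-applyUpTo rowOf length L) (lengths L)))
    where
    lengths : ∀ m → applyUpTo (length ∘ rowOf) m ≡ applyUpTo (c L) m
    lengths m = trans (sym (map-upTo _ m)) (trans (map-cong length-rowOf (upTo m)) (map-upTo _ m))

  tableau-SSYT : IsSSYT (stripTop (λ a → a ≡ᵇ 0) (applyUpTo (c L) L)) L tableau
  tableau-SSYT =
    tableau-shape ,
    stripTop-All null (All.applyUpTo⁺₂ rowOf L λ i → Linked.AllPairs⇒Linked (fill-sorted L _)) ,
    stripTop-All null (All.applyUpTo⁺₂ rowOf L λ i → fill-bounds L _) ,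
    stripTop-Linked null (Linked.applyUpTo⁺₂ rowOf L rowOf-strict)

rowAt : Tableau → ℕ → List ℕ
rowAt []      _       = []
rowAt (R ∷ T) zero    = R
rowAt (R ∷ T) (suc i) = rowAt T i

rowAt-All : ∀ {P : List ℕ → Set} T → P [] → All P T → ∀ i → P (rowAt T i)
rowAt-All []      P[] _        i       = P[]
rowAt-All (R ∷ T) P[] (p ∷ _)  zero    = p
rowAt-All (R ∷ T) P[] (_ ∷ ps) (suc i) = rowAt-All T P[] ps i

rowAt-strict : ∀ T → Linked _≥_ (map length T) → Linked StrictlyBelow T →
               ∀ i k → countLe (suc k) (rowAt T (suc i)) ≤ countLe k (rowAt T i)
rowAt-strict []          _       _       i       k = z≤n
rowAt-strict (R ∷ [])    _       _       zero    k = z≤n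
rowAt-strict (R ∷ [])    _       _       (suc i) k = z≤n
rowAt-strict (R ∷ S ∷ T) (h ∷ _) (s ∷ _) zero    k = StrictlyBelow⇒counts h s k
rowAt-strict (R ∷ S ∷ T) (_ ∷ d) (_ ∷ l) (suc i) k = rowAt-strict (S ∷ T) d l i k

applyUpTo-rowAt : ∀ T L → length T ≤ L → applyUpTo (rowAt T) L ≡ T ++ replicate (L ∸ length T) []
applyUpTo-rowAt []      zero    _       = refl
applyUpTo-rowAt []      (suc L) _       = cong ([] ∷_) (applyUpTo-rowAt [] L z≤n)
applyUpTo-rowAt (R ∷ T) (suc L) (s≤s h) = cong (R ∷_) (applyUpTo-rowAt T L h)

module _ {L : ℕ} {ν : List ℕ} {T : Tableau} (partition : IsPartition ν) (ssyt : IsSSYT ν L T) where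

  private
    shape  = proj₁ ssyt
    sorted = proj₁ (proj₂ ssyt)
    bounds = proj₁ (proj₂ (proj₂ ssyt))
    strict = proj₂ (proj₂ (proj₂ ssyt))

  SSYT-chain : Chain L (λ k i → countLe k (rowAt T i))
  SSYT-chain = record
    { start  = λ i → countLe-All> (All.map proj₁ (rowAt-All T [] bounds i))
    ; grow   = λ k i _ → countLe-mono (rowAt T i) (n≤1+n k)
    ; strict = λ k i _ → rowAt-strict T (subst (Linked _≥_) (sym shape) (proj₁ partition)) strict i k
    }

  open Chain SSYT-chain

  length-rowAt : ∀ i → countLe L (rowAt T i) ≡ length (rowAt T i)
  length-rowAt i = countLe-All≤ (All.map proj₂ (rowAt-All T [] bounds i))

  -- By `vanish` the row with index `L` is empty, whereas the rows of `T` are not, the parts of its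
  -- shape being positive.
  SSYT-height : length T ≤ L
  SSYT-height with length T ≤? L
  ... | yes h = h
  ... | no ¬h = ⊥-elim (1+n≰n (≤-trans (nonempty T L (≰⇒> ¬h) (subst (All (1 ≤_)) (sym shape) (proj₂ partition)))
                                       (≤-reflexive (trans (sym (length-rowAt L)) (vanish L L ≤-refl ≤-refl)))))
    where
    nonempty : ∀ T i → i < length T → All (1 ≤_) (map length T) → 1 ≤ length (rowAt T i)
    nonempty (R ∷ T) zero    _       (p ∷ _)  = p
    nonempty (R ∷ T) (suc i) (s≤s h) (_ ∷ ps) = nonempty T i h ps

  rowOf-rowAt : ∀ i → rowOf i ≡ rowAt T i
  rowOf-rowAt i = sorted-unique (fill-sorted L _)
    (Linked.Linked⇒AllPairs ≤-trans (rowAt-All T [] sorted i))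
    λ k → trans (countLe-rowOf k i) (countLe-⊓ k (All.map proj₂ (rowAt-All T [] bounds i)))

  tableau-SSYT-chain : tableau ≡ T
  tableau-SSYT-chain = begin
    stripTop null (applyUpTo rowOf L)
      ≡⟨ cong (stripTop null) (trans (sym (map-upTo rowOf L)) (trans (map-cong rowOf-rowAt (upTo L)) (map-upTo (rowAt T) L))) ⟩
    stripTop null (applyUpTo (rowAt T) L)
      ≡⟨ cong (stripTop null) (applyUpTo-rowAt T L SSYT-height) ⟩
    stripTop null (T ++ replicate (L ∸ length T) [])
      ≡⟨ stripTop-++ null T _ (nonempty T (subst (All (1 ≤_)) (sym shape) (proj₂ partition))) (All.replicate⁺ _ refl) ⟩
    T ∎
    where
    open ≡-Reasoning
    nonempty : ∀ T → All (1 ≤_) (map length T) → All (λ R → null R ≡ false) T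
    nonempty []            _        = []
    nonempty ((_ ∷ _) ∷ T) (_ ∷ ps) = refl ∷ nonempty T ps

-- The bijection

nth-++ˡ : ∀ xs ys {i} → i < length xs → nth (xs ++ ys) i ≡ nth xs i
nth-++ˡ (x ∷ xs) ys {zero}  _       = refl
nth-++ˡ (x ∷ xs) ys {suc i} (s≤s h) = nth-++ˡ xs ys h

nth-beyond : ∀ xs {i} → length xs ≤ i → nth xs i ≡ 0
nth-beyond []       _               = refl
nth-beyond (x ∷ xs) {suc i} (s≤s h) = nth-beyond xs h

nth-ext : ∀ xs ys → length xs ≡ length ys → (∀ i → i < length xs → nth xs i ≡ nth ys i) → xs ≡ ys
nth-ext []       []       _  _ = refl
nth-ext (x ∷ xs) (y ∷ ys) eq h =
  cong₂ _∷_ (h 0 (s≤s z≤n)) (nth-ext xs ys (suc-injective eq) λ i i< → h (suc i) (s≤s i<))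

applyUpTo-nth : ∀ xs → applyUpTo (nth xs) (length xs) ≡ xs
applyUpTo-nth []       = refl
applyUpTo-nth (x ∷ xs) = cong (x ∷_) (applyUpTo-nth xs)

nth-applyUpTo : ∀ (f : ℕ → ℕ) k i → (k ≤ i → f i ≡ 0) → nth (applyUpTo f k) i ≡ f i
nth-applyUpTo f zero    i       beyond = sym (beyond z≤n)
nth-applyUpTo f (suc k) zero    beyond = refl
nth-applyUpTo f (suc k) (suc i) beyond = nth-applyUpTo (f ∘ suc) k i (beyond ∘ s≤s)

take-++ˡ : ∀ {A : Set} k (xs ys : List A) → k ≤ length xs → take k (xs ++ ys) ≡ take k xs
take-++ˡ zero    xs       ys _       = refl
take-++ˡ (suc k) (x ∷ xs) ys (s≤s h) = cong (x ∷_) (take-++ˡ k xs ys h)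

Chain-pred : ∀ {L c} → Chain (suc L) c → Chain L c
Chain-pred ch = record
  { start  = Chain.start ch
  ; grow   = λ k i k<L → Chain.grow ch k i (m<n⇒m<1+n k<L)
  ; strict = λ k i k<L → Chain.strict ch k i (m<n⇒m<1+n k<L)
  }

⊥≼ : ∀ {n} (R : Subset n) → Sub.⊥ ≼ R
⊥≼ []      = []
⊥≼ {suc n} (b ∷ R) = ≤-trans (≤-reflexive (∣⊥∣≡0 n)) z≤n ∷ ⊥≼ R

applyUpTo-injective : ∀ {A : Set} {f g : ℕ → A} L → applyUpTo f L ≡ applyUpTo g L → ∀ {i} → i < L → f i ≡ g i
applyUpTo-injective (suc L) eq {zero}  _       = ∷-injectiveˡ eq
applyUpTo-injective (suc L) eq {suc i} (s≤s h) = applyUpTo-injective L (∷-injectiveʳ eq) h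

Interlace⇒≤ : ∀ {c′ c} → Interlace c′ c → ∀ i → nth c i ≤ nth c′ i
Interlace⇒≤ [ _ ]             i       = z≤n
Interlace⇒≤ (⟨ p≤a , _ ⟩∷ _) zero    = p≤a
Interlace⇒≤ (⟨ _ , _ ⟩∷ r)   (suc i) = Interlace⇒≤ r i

Interlace⇒strict : ∀ {c′ c} → Interlace c′ c → ∀ i → nth c′ (suc i) ≤ nth c i
Interlace⇒strict [ _ ]             i       = z≤n
Interlace⇒strict (⟨ _ , b≤p ⟩∷ _) zero    = b≤p
Interlace⇒strict (⟨ _ , _ ⟩∷ r)   (suc i) = Interlace⇒strict r i

Interlace-applyUpTo : ∀ {f g : ℕ → ℕ} k → (∀ i → g i ≤ f i) → (∀ i → f (suc i) ≤ g i) →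
                      Interlace (applyUpTo f (suc k)) (applyUpTo g k)
Interlace-applyUpTo zero    _ _ = [ _ ]
Interlace-applyUpTo (suc k) p q = ⟨ p 0 , q 0 ⟩∷ Interlace-applyUpTo k (p ∘ suc) (q ∘ suc)

module _ {n : ℕ} where

  collapse-Nested : (rows : List (Subset n)) → Nested (collapse rows)
  collapse-Nested rows = go [] rows []
    where
    go : ∀ acc rows → Nested acc → Nested (foldl insertRow acc rows)
    go acc []         N = N
    go acc (y ∷ rows) N = go (insertRow acc y) rows (⋉⇒Nested (Insert⇒⋉ N (Insert-total acc y)))

  collapse-∷ʳ : ∀ (rows : List (Subset n)) y → Insert (collapse rows) y (collapse (rows ∷ʳ y))
  collapse-∷ʳ rows y = subst (Insert _ y) (sym (foldl-∷ʳ insertRow [] y rows)) (Insert-total (collapse rows) y)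

  -- The chain of shapes behind `ρQ`: stage `k` consists of the row sizes once `k` rows are
  -- inserted.
  profile : List (Subset n) → ℕ → ℕ → ℕ
  profile rows k = nth (sizes (collapse (take k rows)))

  length-sizes : ∀ (rows : List (Subset n)) → length (sizes (collapse rows)) ≡ length rows
  length-sizes rows = trans (length-map ∣_∣ (collapse rows)) (foldl-insertRow-length [] rows)

  length-sizes-take : ∀ {k} (rows : List (Subset n)) → k ≤ length rows → length (sizes (collapse (take k rows))) ≡ k
  length-sizes-take {k} rows k≤ = trans (length-sizes (take k rows)) (trans (length-take k rows) (m≤n⇒m⊓n≡m k≤))

  profile-interlace : ∀ {k} (rows : List (Subset n)) → k < length rows →
                      Interlace (sizes (collapse (take (suc k) rows))) (sizes (collapse (take k rows)))
  profile-interlace {k} rows k< with y , eq , _ ← take-∷ʳ k rows k< rewrite eq =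
    ⋉⇒Interlace (Insert⇒⋉ (collapse-Nested (take k rows)) (collapse-∷ʳ (take k rows) y))

  profile-Chain : ∀ (rows : List (Subset n)) → Chain (length rows) (profile rows)
  profile-Chain rows = record
    { start  = λ _ → refl
    ; grow   = λ k i k< → Interlace⇒≤ (profile-interlace rows k<) i
    ; strict = λ k i k< → Interlace⇒strict (profile-interlace rows k<) i
    }

  profile-full : ∀ (rows : List (Subset n)) → applyUpTo (profile rows (length rows)) (length rows) ≡ sizes (collapse rows)
  profile-full rows rewrite take-all (length rows) rows ≤-refl =
    trans (cong (applyUpTo (nth (sizes (collapse rows)))) (sym (length-sizes rows))) (applyUpTo-nth (sizes (collapse rows)))

  -- In `pre` the rows not yet inserted still lie on top; the test on the row number in `cnt` cuts
  -- off exactly these.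
  cnt-profile : ∀ {L} (B : BallSystem L n) k i → k ≤ L → cnt B k (suc i) ≡ profile (toList B) k i
  cnt-profile B zero    i _   = refl
  cnt-profile {L} B (suc k) i k<L with i <? suc k
  ... | yes i≤k rewrite dec-true (i <? suc k) i≤k | pre-collapse k B k<L
                      | map-++ ∣_∣ (collapse (take (suc k) (toList B))) (drop (suc k) (toList B)) =
    nth-++ˡ (sizes (collapse (take (suc k) (toList B)))) _ (≤-trans i≤k (≤-reflexive (sym long)))
    where long = length-sizes-take (toList B) (≤-trans k<L (≤-reflexive (sym (length-toList B))))
  ... | no i≰k rewrite dec-false (i <? suc k) i≰k =
    sym (nth-beyond (sizes (collapse (take (suc k) (toList B)))) (≤-trans (≤-reflexive long) (≮⇒≥ i≰k)))
    where long = length-sizes-take (toList B) (≤-trans k<L (≤-reflexive (sym (length-toList B))))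

  chain : ∀ {L} (B : BallSystem L n) → Chain L (profile (toList B))
  chain B = subst (λ L → Chain L (profile (toList B))) (length-toList B) (profile-Chain (toList B))

  chain-sizes : ∀ {L} (B : BallSystem L n) → applyUpTo (profile (toList B) L) L ≡ sizes (collapse (toList B))
  chain-sizes B = subst (λ L → applyUpTo (profile (toList B) L) L ≡ sizes (collapse (toList B)))
                        (length-toList B) (profile-full (toList B))

  ρQ-tableau : ∀ {L} (B : BallSystem L n) → ρQ B ≡ Chain.tableau (chain B)
  ρQ-tableau {L} B = cong (stripTop null)
    (trans (sym (map-∘ (upTo L))) (trans (map-cong row (upTo L)) (map-upTo (Chain.rowOf (chain B)) L)))
    where
    row : ∀ i → concatMap (λ k → replicate (cnt B k (suc i) ∸ cnt B (k ∸ 1) (suc i)) k) (map suc (upTo L)) ≡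
                fill L (λ k → profile (toList B) k i)
    row i = trans (fill-concatMap L (λ k → cnt B k (suc i))) (fill-cong L λ k → cnt-profile B k i)

  isEmpty : Subset n → Bool
  isEmpty R = ∣ R ∣ ≡ᵇ 0

  ρN-MLQ-collapse : ∀ {L} (B : BallSystem L n) → ρN-MLQ B ≡ stripTop isEmpty (collapse (toList B))
  ρN-MLQ-collapse B = cong (stripTop isEmpty) (ρN-collapse B)

  -- The final stage of the chain lists the row sizes of `ρN B`, so trimming gives both components
  -- the same shape.
  ρ-InTarget : ∀ L (B : BallSystem L n) → InTarget L n (ρ B)
  ρ-InTarget L B with conj-surjective (stripTop (λ a → a ≡ᵇ 0) (sizes N))
                        (stripTop-partition (Linked.map⁺ (Linked.map ≼-size (collapse-Nested (toList B)))))
    where N = collapse (toList B)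
  ... | μ , P , conj≡ν , _ = μ , P , (sizes≡ , Nested⇒maj≡0 (ρN-MLQ B) nested) , ssyt
    where
    nested : Nested (ρN-MLQ B)
    nested = subst Nested (sym (ρN-MLQ-collapse B)) (stripTop-Linked isEmpty (collapse-Nested (toList B)))
    sizes≡ : sizes (ρN-MLQ B) ≡ conj μ
    sizes≡ = trans (cong sizes (ρN-MLQ-collapse B))
      (trans (stripTop-map isEmpty (λ a → a ≡ᵇ 0) ∣_∣ (λ _ → refl) (collapse (toList B))) (sym conj≡ν))
    ssyt : IsSSYT (conj μ) L (ρQ B)
    ssyt = subst₂ (λ ν T → IsSSYT ν L T)
      (trans (cong (stripTop (λ a → a ≡ᵇ 0)) (chain-sizes B)) (sym conj≡ν)) (sym (ρQ-tableau B))
      (Chain.tableau-SSYT (chain B))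

isEmpty-unique : ∀ {n} (R : Subset n) → isEmpty R ≡ true → R ≡ Sub.⊥
isEmpty-unique []          _ = refl
isEmpty-unique (false ∷ R) e = cong (false ∷_) (isEmpty-unique R e)

null-unique : ∀ (R : List ℕ) → null R ≡ true → R ≡ []
null-unique [] _ = refl

module _ {n : ℕ} where

  -- The row inserted last is peeled off each time; the sizes of the earlier stage are what
  -- `Insert-injective` asks for.
  collapse-injective : ∀ (rows rows₁ : List (Subset n)) → length rows ≡ length rows₁ → collapse rows ≡ collapse rows₁ →
    (∀ k → k < length rows → sizes (collapse (take k rows)) ≡ sizes (collapse (take k rows₁))) → rows ≡ rows₁
  collapse-injective rows rows₁ |≡| eq h =
    trans (sym (take-all m rows ≤-refl))
      (trans (go m ≤-refl (subst₂ (λ r r₁ → collapse r ≡ collapse r₁) (sym (take-all m rows ≤-refl)) (sym take-all₁) eq)) take-all₁)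
    where
    m = length rows
    take-all₁ : take m rows₁ ≡ rows₁
    take-all₁ = take-all m rows₁ (≤-reflexive (sym |≡|))
    go : ∀ k → k ≤ m → collapse (take k rows) ≡ collapse (take k rows₁) → take k rows ≡ take k rows₁
    go zero    _   _ = refl
    go (suc k) k<m eq
      with y , t , _ ← take-∷ʳ k rows k<m | y₁ , t₁ , _ ← take-∷ʳ k rows₁ (subst (k <_) |≡| k<m)
      with below , refl ← Insert-injective
             (subst (Insert _ y) (cong collapse (sym t)) (collapse-∷ʳ (take k rows) y))
             (subst (Insert _ y₁) (trans (cong collapse (sym t₁)) (sym eq)) (collapse-∷ʳ (take k rows₁) y₁)) (h k k<m) =
      trans t (trans (cong (_∷ʳ y) (go k (<⇒≤ k<m) below)) (sym t₁))

  -- Knowing `L` undoes the trimming, and counting the entries at most `k` in each row of the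
  -- tableau recovers the sizes after `k` insertions.
  ρ-injective : ∀ {L} (B B′ : BallSystem L n) → ρ B ≡ ρ B′ → B ≡ B′
  ρ-injective {L} B B′ eq = trans (sym (cast-is-id refl B)) (toList-injective refl B B′
    (collapse-injective rows rows′ |≡| N≡N′ sizes≡))
    where
    rows = toList B
    rows′ = toList B′
    |≡| : length rows ≡ length rows′
    |≡| = trans (length-toList B) (sym (length-toList B′))
    N≡N′ : collapse rows ≡ collapse rows′
    N≡N′ = stripTop-injective isEmpty Sub.⊥ isEmpty-unique (collapse rows) (collapse rows′)
      (trans (foldl-insertRow-length [] rows) (trans |≡| (sym (foldl-insertRow-length [] rows′))))
      (trans (sym (ρN-MLQ-collapse B)) (trans (cong proj₁ eq) (ρN-MLQ-collapse B′)))
    rowOf≡ : applyUpTo (Chain.rowOf (chain B)) L ≡ applyUpTo (Chain.rowOf (chain B′)) L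
    rowOf≡ = stripTop-injective null [] null-unique _ _ (trans (length-applyUpTo _ L) (sym (length-applyUpTo _ L)))
      (trans (sym (ρQ-tableau B)) (trans (cong proj₂ eq) (ρQ-tableau B′)))
    profile≡ : ∀ k i → k ≤ L → i < L → profile rows k i ≡ profile rows′ k i
    profile≡ k i k≤L i<L = begin
      profile rows k i                        ≡⟨ cong (λ k → profile rows k i) (m≤n⇒m⊓n≡m k≤L) ⟨
      profile rows (k ⊓ L) i                  ≡⟨ Chain.countLe-rowOf (chain B) k i ⟨
      countLe k (Chain.rowOf (chain B) i)     ≡⟨ cong (countLe k) (applyUpTo-injective L rowOf≡ i<L) ⟩
      countLe k (Chain.rowOf (chain B′) i)    ≡⟨ Chain.countLe-rowOf (chain B′) k i ⟩
      profile rows′ (k ⊓ L) i                 ≡⟨ cong (λ k → profile rows′ k i) (m≤n⇒m⊓n≡m k≤L) ⟩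
      profile rows′ k i                       ∎
      where open ≡-Reasoning
    sizes≡ : ∀ k → k < length rows → sizes (collapse (take k rows)) ≡ sizes (collapse (take k rows′))
    sizes≡ k k< = nth-ext _ _ (trans long (sym (length-sizes-take rows′ (<⇒≤ (subst (k <_) |≡| k<)))))
      λ i i< → profile≡ k i (<⇒≤ k<L) (<-trans (subst (i <_) long i<) k<L)
      where
      long = length-sizes-take rows (<⇒≤ k<)
      k<L = subst (k <_) (length-toList B) k<

  -- The last two stages of the chain interlace, so one insertion can be undone; what remains is
  -- nested, with sizes given by the shorter chain.
  collapse-surjective : ∀ {L c} (N : List (Subset n)) → Nested N → Chain L c → sizes N ≡ applyUpTo (c L) L →
    ∃ λ rows → length rows ≡ L × collapse rows ≡ N × (∀ k → k ≤ L → sizes (collapse (take k rows)) ≡ applyUpTo (c k) k)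
  collapse-surjective {zero}      [] _ _ _ = [] , refl , refl , λ { zero _ → refl }
  collapse-surjective {suc L} {c} N nested ch sizes≡
    with xs , y , ins , xs≡ , nested′ ← Insert-surjective N (applyUpTo (c L) L) nested
           (subst (λ s → Interlace s (applyUpTo (c L) L)) (sym sizes≡)
             (Interlace-applyUpTo L (λ i → Chain.grow ch L i ≤-refl) (λ i → Chain.strict ch L i ≤-refl)))
    with rows , refl , refl , prefix ← collapse-surjective xs nested′ (Chain-pred ch) xs≡ =
    rows ∷ʳ y , long , collapse≡ , sizes-take
    where
    long : length (rows ∷ʳ y) ≡ suc (length rows)
    long = trans (length-++ rows) (+-comm (length rows) 1)
    collapse≡ : collapse (rows ∷ʳ y) ≡ N
    collapse≡ = trans (foldl-∷ʳ insertRow [] y rows) (Insert-functional ins)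
    sizes-take : ∀ k → k ≤ suc (length rows) → sizes (collapse (take k (rows ∷ʳ y))) ≡ applyUpTo (c k) k
    sizes-take k k≤ with m≤n⇒m<n∨m≡n k≤
    ... | inj₁ (s≤s k≤L) = trans (cong (sizes ∘ collapse) (take-++ˡ k rows (y ∷ []) k≤L)) (prefix k k≤L)
    ... | inj₂ refl = trans (cong (sizes ∘ collapse) (take-all (suc (length rows)) (rows ∷ʳ y) (≤-reflexive long)))
                            (trans (cong sizes collapse≡) sizes≡)

  Nested-pad : ∀ k {M : List (Subset n)} → Nested M → Nested (M ++ replicate k Sub.⊥)
  Nested-pad zero          []          = []
  Nested-pad (suc zero)    []          = [-]
  Nested-pad (suc (suc k)) []          = ⊥≼ Sub.⊥ ∷ Nested-pad (suc k) []
  Nested-pad zero          [-]         = [-]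
  Nested-pad (suc k)       [-]         = ⊥≼ _ ∷ Nested-pad (suc k) []
  Nested-pad k             (R≼S ∷ N)   = R≼S ∷ Nested-pad k N

  ρ-surjective : ∀ L (M : List (Subset n)) T → InTarget L n (M , T) → ∃ λ (B : BallSystem L n) → ρ B ≡ (M , T)
  ρ-surjective L M T (μ , _ , (M≡ , maj≡0) , ssyt) = B , cong₂ _,_ ρN≡ ρQ≡
    where
    P : IsPartition (conj μ)
    P = conj-partition μ
    ch : Chain L (λ k i → countLe k (rowAt T i))
    ch = SSYT-chain P ssyt
    -- Empty rows restore the height `L`, which is enough room: `M` has as many rows as `T`, and `T`
    -- has at most `L`.
    N : List (Subset n)
    N = M ++ replicate (L ∸ length M) Sub.⊥
    |M|≡|T| : length M ≡ length T
    |M|≡|T| = trans (sym (length-map ∣_∣ M)) (trans (cong length (trans M≡ (sym (proj₁ ssyt)))) (length-map length T))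
    nested : Nested N
    nested = Nested-pad (L ∸ length M) (maj≡0⇒Nested M (Linked.map⁻ (subst (Linked _≥_) (sym M≡) (proj₁ P))) maj≡0)
    sizes≡ : sizes N ≡ applyUpTo (λ i → countLe L (rowAt T i)) L
    sizes≡ = begin
      sizes N
        ≡⟨ map-++ ∣_∣ M (replicate (L ∸ length M) Sub.⊥) ⟩
      sizes M ++ map ∣_∣ (replicate (L ∸ length M) Sub.⊥)
        ≡⟨ cong₂ _++_ (trans M≡ (sym (proj₁ ssyt))) (trans (map-replicate ∣_∣ (L ∸ length M) Sub.⊥) (cong₂ (λ m z → replicate (L ∸ m) z) |M|≡|T| (∣⊥∣≡0 n))) ⟩
      map length T ++ replicate (L ∸ length T) 0
        ≡⟨ cong (map length T ++_) (map-replicate length (L ∸ length T) []) ⟨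
      map length T ++ map length (replicate (L ∸ length T) [])
        ≡⟨ map-++ length T (replicate (L ∸ length T) []) ⟨
      map length (T ++ replicate (L ∸ length T) [])
        ≡⟨ cong (map length) (applyUpTo-rowAt T L (SSYT-height P ssyt)) ⟨
      map length (applyUpTo (rowAt T) L)
        ≡⟨ trans (cong (map length) (sym (map-upTo (rowAt T) L))) (sym (map-∘ (upTo L))) ⟩
      map (length ∘ rowAt T) (upTo L)
        ≡⟨ map-cong (λ i → sym (length-rowAt P ssyt i)) (upTo L) ⟩
      map (λ i → countLe L (rowAt T i)) (upTo L)
        ≡⟨ map-upTo (λ i → countLe L (rowAt T i)) L ⟩
      applyUpTo (λ i → countLe L (rowAt T i)) L ∎
      where open ≡-Reasoning
    preimage = collapse-surjective N nested ch sizes≡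
    rows = proj₁ preimage
    B : BallSystem L n
    B = subst (Vec (Subset n)) (proj₁ (proj₂ preimage)) (fromList rows)
    toList-subst : ∀ {m L} (eq : m ≡ L) (v : Vec (Subset n) m) → toList (subst (Vec (Subset n)) eq v) ≡ toList v
    toList-subst refl v = refl
    B≡ : toList B ≡ rows
    B≡ = trans (toList-subst (proj₁ (proj₂ preimage)) (fromList rows)) (toList∘fromList rows)
    nonempty : ∀ {R : Subset n} → 1 ≤ ∣ R ∣ → isEmpty R ≡ false
    nonempty {R} _ with suc _ ← ∣ R ∣ = refl
    ρN≡ : ρN-MLQ B ≡ M
    ρN≡ = begin
      ρN-MLQ B                                ≡⟨ ρN-MLQ-collapse B ⟩
      stripTop isEmpty (collapse (toList B))  ≡⟨ cong (stripTop isEmpty ∘ collapse) B≡ ⟩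
      stripTop isEmpty (collapse rows)        ≡⟨ cong (stripTop isEmpty) (proj₁ (proj₂ (proj₂ preimage))) ⟩
      stripTop isEmpty N                      ≡⟨ stripTop-++ isEmpty M _
                                                   (All.map (λ {R} → nonempty {R}) (All.map⁻ (subst (All (1 ≤_)) (sym M≡) (proj₂ P))))
                                                   (All.replicate⁺ _ (cong (_≡ᵇ 0) (∣⊥∣≡0 n))) ⟩
      M                                       ∎
      where open ≡-Reasoning
    profile≡ : ∀ k i → k ≤ L → profile (toList B) k i ≡ countLe k (rowAt T i)
    profile≡ k i k≤L = trans (cong (λ r → profile r k i) B≡)
      (trans (cong (λ s → nth s i) (proj₂ (proj₂ (proj₂ preimage)) k k≤L))
             -- Stage `k` lists only `k` rows; the higher rows of `T` have no entry at most `k`.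
             (nth-applyUpTo (λ i → countLe k (rowAt T i)) k i (Chain.vanish ch k i k≤L)))
    ρQ≡ : ρQ B ≡ T
    ρQ≡ = begin
      ρQ B                                               ≡⟨ ρQ-tableau B ⟩
      Chain.tableau (chain B)                            ≡⟨ cong (stripTop null) (map-upTo _ L) ⟨
      stripTop null (map (Chain.rowOf (chain B)) (upTo L))
        ≡⟨ cong (stripTop null) (map-cong (λ i → fill-cong L λ k → profile≡ k i) (upTo L)) ⟩
      stripTop null (map (Chain.rowOf ch) (upTo L))      ≡⟨ cong (stripTop null) (map-upTo _ L) ⟩
      Chain.tableau ch                                   ≡⟨ tableau-SSYT-chain P ssyt ⟩
      T                                                  ∎
      where open ≡-Reasoning

theorem4p19 : ∀ {c ℓ} (L n : ℕ) →
    (∀ (B : BallSystem L n) → InTarget L n (ρ B))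
    × (∀ (B B′ : BallSystem L n) → ρ B ≡ ρ B′ → B ≡ B′)
    × (∀ (M : List (Subset n)) (T : Tableau) → InTarget L n (M , T) →
    ∃ λ (B : BallSystem L n) → ρ B ≡ (M , T))
    × (∀ (CM : CommutativeMonoid c ℓ) (x : Fin n → CommutativeMonoid.Carrier CM)
    (B : BallSystem L n) → CommutativeMonoid._≈_ CM (weight CM x B) (weight CM x (ρN B)))
theorem4p19 L n = ρ-InTarget L , ρ-injective , ρ-surjective L , λ CM x B → weight-ρN CM x B
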